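{- For every integer $n\ge 1$, $|\mathcal{S}_n(31;\,2\to 3)| = B^*_n$, where $B^*_n$ denotes the $n$-th Bessel number.
   Context: $[n]=\{1,\dots,n\}$, and $\mathcal{S}_n$ is the set of permutations $\pi=\pi_1\pi_2\cdots\pi_n$ of $[n]$ in one-line notation. The permutation $\hat\pi$: for $\pi\in\mathcal{S}_n$, $\hat\pi\in\mathcal{S}_n$ is the permutation whose cycle form is obtained from the word $\pi_1\cdots\pi_n$ by inserting a left parenthesis before each left-to-right maximum (an entry larger than all entries to its left) and a right parenthesis immediately before the next left-to-right maximum, or at the end of the word. A cycle $(c_1,c_2,\dots,c_s)$ means $c_1\mapsto c_2\mapsto\cdots\mapsto c_s\mapsto c_1$. Example: if $\pi=2537164$ then $\hat\pi=(2)(53)(7164)$. Arrow patterns: an arrow pattern of size $k$ is a pair $(\nu;H)$ where $\nu=\nu_1\cdots\nu_m$ is a word of distinct positive integers, $H$ is a collection of arrows $b_i\to c_i$, and the set of all integers appearing in $\nu$ or $H$ is $[k]$. A permutation $\pi\in\mathcal{S}_n$ contains $(\nu;H)$ if there are a set $X=\{x_1<x_2<\cdots<x_k\}\subseteq[n]$ and indices $t_1<\cdots<t_m$ such that $\pi_{t_1}\pi_{t_2}\cdots\pi_{t_m}=x_{\nu_1}x_{\nu_2}\cdots x_{\nu_m}$ and $\hat\pi(x_{b_i})=x_{c_i}$ for every arrow $b_i\to c_i$ in $H$. Otherwise $\pi$ avoids $(\nu;H)$. $\mathcal{S}_n(\nu;H)$ is the set of permutations in $\mathcal{S}_n$ avoiding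 $(\nu;H)$. The Bessel number $B^*_n$ (OEIS A006789; the values for $n=0,1,2,\dots$ are $1,1,2,5,14,43,143,509,\dots$) is the number of non-overlapping set partitions of $[n]$, i.e. set partitions having no two blocks $A,B$ with $\min A<\min B<\max A<\max B$. -}

module Defs where

open import Data.Bool.Base using (true; false)
open import Data.Fin.Base using (Fin; _<_; _≤_)
open import Data.Fin.Patterns using (0F; 1F; 2F)
open import Data.Fin.Properties using (_≟_; _<?_; _≤?_; any?; all?)
open import Data.Fin.Subset using (Subset; inside; outside; _∈_; _∩_; Nonempty; Empty)
open import Data.Fin.Subset.Properties using (_∈?_; nonempty?)
open import Data.List.Base as List
  using (List; []; _∷_; [_]; _++_; allFin; cartesianProductWith; filter; foldr; length)
open import Data.List.Membership.Propositional using () renaming (_∈_ to _∈ˡ_)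
open import Data.List.NonEmpty.Base using (List⁺; _∷_)
open import Data.List.Relation.Unary.All as All using (All)
open import Data.List.Relation.Unary.AllPairs as AllPairs using (AllPairs)
open import Data.List.Relation.Unary.Any as Any using (Any; here; there)
open import Data.Nat.Base using (ℕ; zero; suc)
open import Data.Product.Base using (_×_; _,_; ∃; ∃-syntax)
open import Data.Sum.Base using (_⊎_; inj₁; inj₂)
open import Data.Vec.Base as Vec using (Vec; []; _∷_; lookup; toList)
open import Data.Vec.Properties using (≡-dec)
import Data.Vec.Relation.Unary.All as VecAll
import Data.Vec.Relation.Unary.AllPairs as VecAllPairs
open import Data.Vec.Relation.Unary.Unique.Propositional using (Unique)
open import Function.Base using (id; _∘_)
open import Relation.Binary.PropositionalEquality.Core using (_≡_)
open import Relation.Nullary.Decidable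
  using (Dec; does; map′; ¬?; _×-dec_; _→-dec_)
open import Relation.Nullary.Negation using (¬_)
open import Relation.Unary using (Decidable)

private
  variable
    A : Set
    k m n : ℕ

-- Throughout, [n] = {1,…,n} is represented by Fin n, so that every letter is
-- shifted down by one; only the order of the letters matters.

-- All words of length m over the given letters, each listed once if the
-- letters are distinct.
words : List A → ∀ m → List (Vec A m)
words as zero    = [ [] ]
words as (suc m) = cartesianProductWith _∷_ as (words as m)

anyWord? : ∀ {m} {P : Vec (Fin n) m → Set} → Decidable P → Dec (∃ P)
anyWord? {m = zero}  P? = map′ (λ p → [] , p) (λ { ([] , p) → p }) (P? [])
anyWord? {m = suc m} P? =
  map′ (λ { (a , w , p) → a ∷ w , p }) (λ { (a ∷ w , p) → a , w , p })
       (any? λ a → anyWord? (P? ∘ (a ∷_)))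

Increasing : Vec (Fin n) m → Set
Increasing xs = ∀ i j → i < j → lookup xs i < lookup xs j

increasing? : Decidable (Increasing {n} {m})
increasing? xs =
  all? λ i → all? λ j → (i <? j) →-dec (lookup xs i <? lookup xs j)

------------------------------------------------------------------------
-- Permutations in one-line notation

-- A word of length n over Fin n without repeated letters.
unique? : Decidable (Unique {A = Fin n} {m})
unique? = VecAllPairs.allPairs? (λ i j → ¬? (i ≟ j))

permutations : ∀ n → List (Vec (Fin n) n)
permutations n = filter unique? (words (allFin n) n)

------------------------------------------------------------------------
-- The permutation π̂

-- Given the running maximum c of a word, the letters before the next
-- left-to-right maximum, and the cycles cut out of the remaining word.  The
-- running maximum is always the first letter of the current cycle.
cutAfter : Fin n → List (Fin n) → List (Fin n) × List (List⁺ (Fin n))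
cutAfter c []       = [] , []
cutAfter c (x ∷ xs) with does (c <? x)
... | true  = let ys , cs = cutAfter x xs in [] , (x ∷ ys) ∷ cs
... | false = let ys , cs = cutAfter c xs in x ∷ ys , cs

cycleForm : List (Fin n) → List (List⁺ (Fin n))
cycleForm []       = []
cycleForm (x ∷ xs) = let ys , cs = cutAfter x xs in (x ∷ ys) ∷ cs

-- successor c x xs y is the image of y when x ∷ xs is a final segment of a
-- cycle with first letter c; letters not in the segment are fixed.
successor : Fin n → Fin n → List (Fin n) → Fin n → Fin n
successor c x []        y with does (y ≟ x)
... | true  = c
... | false = y
successor c x (x′ ∷ xs) y with does (y ≟ x)
... | true  = x′
... | false = successor c x′ xs y

cycle : List⁺ (Fin n) → Fin n → Fin n
cycle (c ∷ cs) = successor c c cs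

-- The cycles are disjoint, so the order of composition is immaterial.
hat : Vec (Fin n) n → Fin n → Fin n
hat π = foldr (λ c f → cycle c ∘ f) id (cycleForm (toList π))

------------------------------------------------------------------------
-- Arrow patterns

record ArrowPattern (k : ℕ) : Set where
  field
    {len}    : ℕ
    ν        : Vec (Fin k) len
    H        : List (Fin k × Fin k)
    distinct : Unique ν
    covers   : ∀ i → i ∈ˡ toList ν ⊎ Any (λ (b , c) → i ≡ b ⊎ i ≡ c) H

Contains : ArrowPattern k → Vec (Fin n) n → Set
Contains {k} {n} σ π =
  ∃[ x ] ∃[ t ] Increasing {n} {k} x × Increasing {n} {len} t
    × Vec.map (lookup π) t ≡ Vec.map (lookup x) ν
    × All (λ (b , c) → hat π (lookup x b) ≡ lookup x c) H
  where open ArrowPattern σ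

contains? : (σ : ArrowPattern k) → Decidable (Contains {n = n} σ)
contains? σ π = anyWord? λ x → anyWord? λ t →
  increasing? x ×-dec increasing? t
    ×-dec ≡-dec _≟_ _ _
    ×-dec All.all? (λ (b , c) → hat π (lookup x b) ≟ lookup x c) H
  where open ArrowPattern σ

Avoids : ArrowPattern k → Vec (Fin n) n → Set
Avoids σ π = ¬ Contains σ π

𝓢 : ∀ n → ArrowPattern k → List (Vec (Fin n) n)
𝓢 n σ = filter (λ π → ¬? (contains? σ π)) (permutations n)

-- (31; 2→3), with 1, 2, 3 written 0F, 1F, 2F.
⟨31⨾2→3⟩ : ArrowPattern 3
⟨31⨾2→3⟩ = record
  { ν        = 2F ∷ 0F ∷ []
  ; H        = (1F , 2F) ∷ []
  ; distinct = ((λ ()) VecAll.∷ VecAll.[]) VecAllPairs.∷ (VecAll.[] VecAllPairs.∷ VecAllPairs.[])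
  ; covers   = λ where
      0F → inj₁ (there (here _≡_.refl))
      1F → inj₂ (here (inj₁ _≡_.refl))
      2F → inj₁ (here _≡_.refl)
  }

------------------------------------------------------------------------
-- Bessel numbers

sublists : List A → List (List A)
sublists []       = [ [] ]
sublists (x ∷ xs) = List.map (x ∷_) (sublists xs) ++ sublists xs

subsets : ∀ n → List (Subset n)
subsets n = words (inside ∷ outside ∷ []) n

-- A set of subsets of [n] is represented by the list of its members in the
-- order in which they occur in subsets n, so that each is listed once here.
families : ∀ n → List (List (Subset n))
families n = sublists (subsets n)

-- For a family P without repetitions.
IsSetPartition : List (Subset n) → Set
IsSetPartition P =
  All Nonempty P × AllPairs (λ A B → Empty (A ∩ B)) P × (∀ i → Any (i ∈_) P)

isSetPartition? : Decidable (IsSetPartition {n})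
isSetPartition? P =
  All.all? nonempty? P
    ×-dec AllPairs.allPairs? (λ A B → ¬? (nonempty? (A ∩ B))) P
    ×-dec all? (λ i → Any.any? (i ∈?_) P)

IsMin IsMax : Subset n → Fin n → Set
IsMin A a = a ∈ A × (∀ x → x ∈ A → a ≤ x)
IsMax A a = a ∈ A × (∀ x → x ∈ A → x ≤ a)

isMin? : (A : Subset n) → Decidable (IsMin A)
isMin? A a = (a ∈? A) ×-dec all? (λ x → (x ∈? A) →-dec (a ≤? x))

isMax? : (A : Subset n) → Decidable (IsMax A)
isMax? A a = (a ∈? A) ×-dec all? (λ x → (x ∈? A) →-dec (x ≤? a))

-- min A < min B < max A < max B
Overlap : Subset n → Subset n → Set
Overlap A B = ∃[ a ] ∃[ b ] ∃[ c ] ∃[ d ]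
  (IsMin A a × IsMin B b × IsMax A c × IsMax B d) × a < b × b < c × c < d

overlap? : (A B : Subset n) → Dec (Overlap A B)
overlap? A B = any? λ a → any? λ b → any? λ c → any? λ d →
  (isMin? A a ×-dec isMin? B b ×-dec isMax? A c ×-dec isMax? B d)
    ×-dec (a <? b) ×-dec (b <? c) ×-dec (c <? d)

NonOverlapping : List (Subset n) → Set
NonOverlapping P = All (λ A → All (λ B → ¬ Overlap A B) P) P

nonOverlapping? : Decidable (NonOverlapping {n})
nonOverlapping? P = All.all? (λ A → All.all? (λ B → ¬? (overlap? A B)) P) P

nonOverlappingPartitions : ∀ n → List (List (Subset n))
nonOverlappingPartitions n =
  filter (λ P → isSetPartition? P ×-dec nonOverlapping? P) (families n)

B* : ℕ → ℕ
B* n = length (nonOverlappingPartitions n)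

{-# OPTIONS --safe #-}
module Submission where

-- In an avoider every cycle of π̂ is written as a decreasing block of the word,
-- and the last letter b of a block of size at least 2 is smaller than everything
-- to the right of the block, since it is followed in π̂ by the maximum of its
-- block.  So avoiders are the set partitions without two blocks
-- min B < min A < max A < max B in which A has at least two elements.  On the
-- other side, min A < min B < max A < max B is forbidden.
--
-- Read [n] downwards, so that a block opens at its maximum and closes at its
-- minimum.  Each element is a singleton block, opens a block, joins one of the
-- currently open blocks, or closes one of them.  The first condition says that
-- the block to be closed is always the one that has been open the longest (a
-- queue), the second that it is the one opened last (a stack).  Either way the
-- choice is forced, so the number of completions depends only on how many blocks
-- are open, and the two counts agree.

open import Defs

open import Data.Bool.Base using (true; false)
import Data.Bool.Properties as Bool
open import Data.Empty using (⊥; ⊥-elim)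
open import Data.Fin.Base using (Fin; zero; suc; toℕ; fromℕ<; _<_; _≤_; opposite)
import Data.Fin.Properties as Fin
open import Data.Fin.Subset as Subset using (Subset; inside; outside; _∩_; Nonempty; Empty)
import Data.Fin.Subset.Properties as Subset
open import Data.List.Base as List
  using (List; []; _∷_; [_]; _++_; length; filter; foldr; allFin; concat; tabulate;
         cartesianProductWith)
import Data.List.Properties as List
open import Data.List.Membership.DecPropositional using (_∈?_)
open import Data.List.Membership.Propositional using (_∈_; _∉_; find; lose)
open import Data.List.Membership.Propositional.Properties
  using (∈-++⁺ˡ; ∈-++⁺ʳ; ∈-++⁻; ∈-map⁺; ∈-map⁻; ∈-cartesianProductWith⁺; ∈-cartesianProductWith⁻;
         ∈-∃++; ∈-filter⁺; ∈-filter⁻; ∈-allFin; ∈-concat⁺′; ∈-tabulate⁺)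
open import Data.List.NonEmpty.Base as List⁺ using (List⁺; _∷_)
open import Data.List.Relation.Unary.All as All using (All; []; _∷_)
import Data.List.Relation.Unary.All.Properties as All
open import Data.List.Relation.Unary.AllPairs as AllPairs using (AllPairs; []; _∷_)
import Data.List.Relation.Unary.AllPairs.Properties as AllPairs
open import Data.List.Relation.Unary.Any using (here; there)
open import Data.List.Relation.Unary.Linked using (Linked; [-]; _∷_)
open import Data.List.Relation.Unary.Linked.Properties using (Linked⇒AllPairs)
open import Data.List.Relation.Unary.Unique.Propositional using (Unique)
import Data.List.Relation.Unary.Unique.Propositional.Properties as Unique
open import Data.Nat.Base as ℕ using (ℕ; zero; suc; _+_; _*_; z≤n; s≤s; _≥_)
import Data.Nat.Properties as ℕ
open import Data.Product.Base using (_×_; _,_; ∃; ∃-syntax; proj₁; proj₂)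
open import Data.Sum.Base using (_⊎_; inj₁; inj₂)
open import Data.Unit.Base using (⊤)
open import Data.Vec.Base as Vec using (Vec; []; _∷_; lookup; toList)
import Data.Vec.Properties as Vec
import Data.Vec.Relation.Unary.All.Properties as VecAll
import Data.Vec.Relation.Unary.AllPairs as Vec
open import Function.Base using (_∘_; id)
open import Relation.Binary.Definitions using (tri<; tri≈; tri>)
open import Relation.Binary.PropositionalEquality
  using (_≡_; _≢_; refl; sym; trans; cong; cong₂; subst)
open import Relation.Nullary using (¬_; Dec; yes; no; does; contradiction)
open import Relation.Nullary.Decidable using (¬?; _×-dec_; dec-true)
open import Relation.Unary using (Decidable)

private
  variable
    A B : Set
    m n : ℕ

-- Decidability, lists and vectors

does-true : (d : Dec A) → does d ≡ true → A
does-true (yes a) _ = a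

does-false : (d : Dec A) → does d ≡ false → ¬ A
does-false (no ¬a) _ = ¬a

length-cartesianProductWith : ∀ {C : Set} (f : A → B → C) xs ys →
  length (cartesianProductWith f xs ys) ≡ length xs * length ys
length-cartesianProductWith f []       ys = refl
length-cartesianProductWith f (x ∷ xs) ys =
  trans (List.length-++ (List.map (f x) ys))
        (cong₂ _+_ (List.length-map (f x) ys) (length-cartesianProductWith f xs ys))

Unique-head : ∀ {x : A} {xs} → Unique (x ∷ xs) → x ∉ xs
Unique-head = Unique.Unique[x∷xs]⇒x∉xs

-- Counting by an injection given as a relation, because partitions and permutations are tied to
-- their labellings by predicates. The partner of the head is deleted from `ys`; by injectivity no
-- other element loses its partner.
length-≤ : (R : A → B → Set) {xs : List A} {ys : List B} → Unique xs →
  (∀ {x} → x ∈ xs → ∃[ y ] y ∈ ys × R x y) →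
  (∀ {x x′ y} → x ∈ xs → x′ ∈ xs → R x y → R x′ y → x ≡ x′) →
  length xs ℕ.≤ length ys
length-≤ R {[]}     _            tot inj = z≤n
length-≤ R {x ∷ xs} x∷xs! tot inj with tot (here refl)
... | y , y∈ys , Rxy with ∈-∃++ y∈ys
... | us , vs , refl = subst (suc (length xs) ℕ.≤_) (sym (List.length-++-sucʳ us y vs))
  (s≤s (length-≤ R (AllPairs.tail x∷xs!) tot′ (λ p q → inj (there p) (there q))))
  where
  drop-y : ∀ {z} → z ≢ y → z ∈ us ++ y ∷ vs → z ∈ us ++ vs
  drop-y z≢y p with ∈-++⁻ us p
  ... | inj₁ q           = ∈-++⁺ˡ q
  ... | inj₂ (here z≡y)  = contradiction z≡y z≢y
  ... | inj₂ (there q)   = ∈-++⁺ʳ us q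
  tot′ : ∀ {x′} → x′ ∈ xs → ∃[ z ] z ∈ us ++ vs × R x′ z
  tot′ p with tot (there p)
  ... | z , q , Rz = z , drop-y (λ { refl → Unique-head x∷xs!
    (subst (_∈ xs) (inj (there p) (here refl) Rz Rxy) p) }) q , Rz

AllPairs-lookup : ∀ {R : A → A → Set} {xs a b} → AllPairs R xs → a ∈ xs → b ∈ xs →
  a ≡ b ⊎ R a b ⊎ R b a
AllPairs-lookup (_ ∷ _)   (here refl) (here refl) = inj₁ refl
AllPairs-lookup (Rx ∷ _)  (here refl) (there q)   = inj₂ (inj₁ (All.lookup Rx q))
AllPairs-lookup (Rx ∷ _)  (there p)   (here refl) = inj₂ (inj₂ (All.lookup Rx p))
AllPairs-lookup (_ ∷ Rxs) (there p)   (there q)   = AllPairs-lookup Rxs p q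

AllPairs-mapWith : ∀ {R S : A → A → Set} {xs} →
  (∀ {a b} → a ∈ xs → b ∈ xs → R a b → S a b) → AllPairs R xs → AllPairs S xs
AllPairs-mapWith f []         = []
AllPairs-mapWith f (Rx ∷ Rxs) =
  All.tabulate (λ b∈ → f (here refl) (there b∈) (All.lookup Rx b∈))
  ∷ AllPairs-mapWith (λ a∈ b∈ → f (there a∈) (there b∈)) Rxs

toList-AllPairs⁺ : ∀ {R : A → A → Set} {xs : Vec A n} → Vec.AllPairs R xs → AllPairs R (toList xs)
toList-AllPairs⁺ Vec.[]         = []
toList-AllPairs⁺ (Rx Vec.∷ Rxs) = VecAll.toList⁺ Rx ∷ toList-AllPairs⁺ Rxs

toList-AllPairs⁻ : ∀ {R : A → A → Set} (xs : Vec A n) → AllPairs R (toList xs) → Vec.AllPairs R xs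
toList-AllPairs⁻ []       []         = Vec.[]
toList-AllPairs⁻ (x ∷ xs) (Rx ∷ Rxs) = VecAll.toList⁻ Rx Vec.∷ toList-AllPairs⁻ xs Rxs

lookup-All : ∀ {P : A → Set} (xs : Vec A n) → All P (toList xs) → ∀ i → P (lookup xs i)
lookup-All (x ∷ xs) (Px ∷ Pxs) zero    = Px
lookup-All (x ∷ xs) (Px ∷ Pxs) (suc i) = lookup-All xs Pxs i

All-lookup : ∀ {P : A → Set} (xs : Vec A n) → (∀ i → P (lookup xs i)) → All P (toList xs)
All-lookup []       P = []
All-lookup (x ∷ xs) P = P zero ∷ All-lookup xs (P ∘ suc)

lookup-AllPairs : ∀ {R : A → A → Set} (xs : Vec A n) → AllPairs R (toList xs) →
  ∀ {i j} → i < j → R (lookup xs i) (lookup xs j)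
lookup-AllPairs (x ∷ xs) (Rx ∷ Rxs) {zero}  {suc j} i<j = lookup-All xs Rx j
lookup-AllPairs (x ∷ xs) (Rx ∷ Rxs) {suc i} {suc j} i<j = lookup-AllPairs xs Rxs (ℕ.s<s⁻¹ i<j)

AllPairs-from-lookup : ∀ {R : A → A → Set} (xs : Vec A n) →
  (∀ {i j} → i < j → R (lookup xs i) (lookup xs j)) → AllPairs R (toList xs)
AllPairs-from-lookup []       R = []
AllPairs-from-lookup (x ∷ xs) R =
  All-lookup xs (λ j → R (s≤s z≤n)) ∷ AllPairs-from-lookup xs (R ∘ s≤s)

fromList-length : ∀ (xs : List A) → length xs ≡ n → ∃[ v ] toList {n = n} v ≡ xs
fromList-length xs refl = Vec.fromList xs , Vec.toList∘fromList xs

-- The heads agree, since otherwise each of them would precede the other. This recovers an avoider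
-- from its labelling.
sorted-ext : ∀ {R : A → A → Set} → (∀ {a b} → R a b → ¬ R b a) → ∀ {xs ys} →
  AllPairs R xs → AllPairs R ys → (∀ {a} → a ∈ xs → a ∈ ys) → (∀ {a} → a ∈ ys → a ∈ xs) → xs ≡ ys
sorted-ext asym {[]}     {[]}     _ _ _ _ = refl
sorted-ext asym {[]}     {y ∷ ys} _ _ _ ⊇ with () ← ⊇ (here refl)
sorted-ext asym {x ∷ xs} {[]}     _ _ ⊆ _ with () ← ⊆ (here refl)
sorted-ext {R = R} asym {x ∷ xs} {y ∷ ys} (Rx ∷ Rxs) (Ry ∷ Rys) ⊆ ⊇
  with x≡y (⊆ (here refl)) (⊇ (here refl))
  where
  x≡y : x ∈ y ∷ ys → y ∈ x ∷ xs → x ≡ y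
  x≡y (here e)  _         = e
  x≡y (there p) (here e)  = sym e
  x≡y (there p) (there q) = ⊥-elim (asym (All.lookup Ry p) (All.lookup Rx q))
... | refl = cong (x ∷_) (sorted-ext asym Rxs Rys
  (λ a∈ → strip Rx (⊆ (there a∈)) a∈) (λ a∈ → strip Ry (⊇ (there a∈)) a∈))
  where
  strip : ∀ {a us vs} → All (R x) us → a ∈ x ∷ vs → a ∈ us → a ∈ vs
  strip Rx (here refl) a∈ = ⊥-elim (asym (All.lookup Rx a∈) (All.lookup Rx a∈))
  strip Rx (there q)   a∈ = q

length-≤-⊆ : ∀ {xs ys : List A} → Unique xs → (∀ {x} → x ∈ xs → x ∈ ys) → length xs ℕ.≤ length ys
length-≤-⊆ xs! xs⊆ys =
  length-≤ _≡_ xs! (λ {x} x∈ → x , xs⊆ys x∈ , refl) (λ { _ _ refl refl → refl })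

-- A missing letter could be adjoined, giving `n + 1` distinct elements of `Fin n`.
unique-complete : ∀ {xs : List (Fin n)} → Unique xs → length xs ≡ n → ∀ z → z ∈ xs
unique-complete {n} {xs} xs! len z with _∈?_ Fin._≟_ z xs
... | yes z∈ = z∈
... | no z∉  = contradiction
  (subst (suc (length xs) ℕ.≤_) (List.length-tabulate id)
    (length-≤-⊆ (All.¬Any⇒All¬ xs z∉ ∷ xs!) (λ {x} _ → ∈-allFin x)))
  (ℕ.<⇒≱ (s≤s (ℕ.≤-reflexive (sym len))))

complete-length : ∀ {xs : List (Fin n)} → Unique xs → (∀ z → z ∈ xs) → length xs ≡ n
complete-length {n} xs! complete = trans
  (ℕ.≤-antisym (length-≤-⊆ xs! (λ {x} _ → ∈-allFin x))
               (length-≤-⊆ (Unique.allFin⁺ n) (λ {x} _ → complete x)))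
  (List.length-tabulate id)

-- Labellings of set partitions by block maxima

-- A discipline keeps the labels (maxima) of the open blocks in a ≺-sorted list,
-- of which only the head may be closed; p is a new label, smaller than all others.
record Discipline (n : ℕ) : Set₁ where
  infix 4 _≺_
  field
    _≺_            : Fin n → Fin n → Set
    asym           : ∀ {a b} → a ≺ b → ¬ b ≺ a
    insert         : Fin n → List (Fin n) → List (Fin n)
    length-insert  : ∀ p s → length (insert p s) ≡ suc (length s)
    ∈-insert⁺ˡ     : ∀ {p} s → p ∈ insert p s
    ∈-insert⁺ʳ     : ∀ {p a s} → a ∈ s → a ∈ insert p s
    ∈-insert⁻      : ∀ {p a} s → a ∈ insert p s → a ≡ p ⊎ a ∈ s
    insert-sorted  : ∀ {p s} → All (p <_) s → AllPairs _≺_ s → AllPairs _≺_ (insert p s)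

  irrefl : ∀ {a b} → a ≡ b → ¬ a ≺ b
  irrefl refl a≺a = asym a≺a a≺a

-- r x is the maximum of the block of x.  The last field says that y can close its
-- block, i.e. be its minimum, only if no ≺-earlier block is open at y.
record Valid (D : Discipline n) (r : Fin n → Fin n) : Set where
  open Discipline D
  field
    inflationary : ∀ x → x ≤ r x
    idempotent   : ∀ x → r (r x) ≡ r x
    disciplined  : ∀ {x y} → x < y → y < r x → y < r y → r x ≺ r y →
                   ∃[ z ] z < y × r z ≡ r y

-- Words list the labels downwards: the head of a word of length m + 1 is the label
-- of the element m.
word : (Fin n → Fin n) → ∀ m → .(m ℕ.≤ n) → Vec (Fin n) m
word r zero    _  = []
word r (suc m) le = r (fromℕ< le) ∷ word r m (ℕ.<⇒≤ le)

word-cong : ∀ {r r′ : Fin n → Fin n} m .(le : m ℕ.≤ n) →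
  (∀ x → toℕ x ℕ.< m → r x ≡ r′ x) → word r m le ≡ word r′ m le
word-cong zero    le eq = refl
word-cong (suc m) le eq = cong₂ _∷_
  (eq _ (s≤s (ℕ.≤-reflexive (Fin.toℕ-fromℕ< le))))
  (word-cong m _ λ x x<m → eq x (ℕ.m<n⇒m<1+n x<m))

-- The value at elements that are not labelled by the word is immaterial.
label : Vec (Fin n) m → Fin n → Fin n
label []                x = x
label {m = suc m} (a ∷ w) x with toℕ x ℕ.≟ m
... | yes _ = a
... | no  _ = label w x

label-top : ∀ (a : Fin n) (w : Vec (Fin n) m) x → toℕ x ≡ m → label (a ∷ w) x ≡ a
label-top {m = m} a w x eq with toℕ x ℕ.≟ m
... | yes _  = refl
... | no  ne = contradiction eq ne

label-below : ∀ (a : Fin n) (w : Vec (Fin n) m) x → toℕ x ℕ.< m → label (a ∷ w) x ≡ label w x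
label-below {m = m} a w x x<m with toℕ x ℕ.≟ m
... | yes eq = contradiction eq (ℕ.<⇒≢ x<m)
... | no  _  = refl

split-< : ∀ {x : Fin n} {m} .(le : m ℕ.< n) → toℕ x ℕ.< suc m → x ≡ fromℕ< le ⊎ toℕ x ℕ.< m
split-< le (s≤s x≤m) with ℕ.m≤n⇒m<n∨m≡n x≤m
... | inj₁ x<m = inj₂ x<m
... | inj₂ eq  = inj₁ (Fin.toℕ-injective (trans eq (sym (Fin.toℕ-fromℕ< le))))

word-label : ∀ (w : Vec (Fin n) m) .(le : m ℕ.≤ n) → word (label w) m le ≡ w
word-label []      le = refl
word-label (a ∷ w) le = cong₂ _∷_
  (label-top a w _ (Fin.toℕ-fromℕ< le))
  (trans (word-cong _ _ (label-below a w)) (word-label w _))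

label-word : ∀ (r : Fin n → Fin n) m .(le : m ℕ.≤ n) x → toℕ x ℕ.< m → label (word r m le) x ≡ r x
label-word r (suc m) le x x<1+m with split-< le x<1+m
... | inj₁ refl = label-top _ _ _ (Fin.toℕ-fromℕ< le)
... | inj₂ x<m  = trans (label-below _ _ x x<m) (label-word r m _ x x<m)

∷-≡ : ∀ {a b : A} {w v : Vec A m} → a ∷ w ≡ b ∷ v → a ≡ b × w ≡ v
∷-≡ refl = refl , refl

∈-map∷ : ∀ {a b : A} {w : Vec A m} {ws} → a ∷ w ∈ List.map (b ∷_) ws → a ≡ b × w ∈ ws
∈-map∷ p with ∈-map⁻ _ p
... | _ , q , refl = refl , q

-- Recursive enumeration of the valid labellings

module Labellings (D : Discipline n) where
  open Discipline D

  -- All labellings of the elements below m such that exactly the labels in s are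
  -- inherited from elements ≥ m.
  mutual
    labellings : ∀ m → .(m ℕ.≤ n) → List (Fin n) → List (Vec (Fin n) m)
    labellings zero    _  []      = [ [] ]
    labellings zero    _  (_ ∷ _) = []
    labellings (suc m) le s =
      cartesianProductWith _∷_ s (labellings m (ℕ.<⇒≤ le) s)
        ++ closings m (ℕ.<⇒≤ le) s
        ++ List.map (fromℕ< le ∷_) (labellings m (ℕ.<⇒≤ le) s)
        ++ List.map (fromℕ< le ∷_) (labellings m (ℕ.<⇒≤ le) (insert (fromℕ< le) s))

    closings : ∀ m → .(m ℕ.≤ n) → List (Fin n) → List (Vec (Fin n) (suc m))
    closings m le []      = []
    closings m le (t ∷ s) = List.map (t ∷_) (labellings m le s)

  -- The four roles of the element `m`. What is known of the elements below is a parameter `P`, so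
  -- that the same case split serves membership in `labellings` and the predicate `Consistent`.
  data Step .(le : m ℕ.< n) (P : List (Fin n) → Set) (s : List (Fin n)) (a : Fin n) : Set where
    continue  : a ∈ s → P s → Step le P s a
    close     : ∀ {s′} → s ≡ a ∷ s′ → P s′ → Step le P s a
    singleton : a ≡ fromℕ< le → P s → Step le P s a
    opener    : a ≡ fromℕ< le → P (insert (fromℕ< le) s) → Step le P s a

  WordStep : ∀ .(le : m ℕ.< n) → List (Fin n) → Fin n → Vec (Fin n) m → Set
  WordStep le s a w = Step le (λ s → w ∈ labellings _ (ℕ.<⇒≤ le) s) s a

  ∈⇒Step : ∀ m .(le : m ℕ.< n) s {a w} → a ∷ w ∈ labellings (suc m) le s → WordStep le s a w
  ∈⇒Step m le s {a} {w} p with ∈-++⁻ (cartesianProductWith _∷_ s (labellings m _ s)) p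
  ... | inj₁ q with ∈-cartesianProductWith⁻ _∷_ s _ q
  ... | _ , _ , a∈ , w∈ , refl = continue a∈ w∈
  ∈⇒Step m le s {a} {w} p | inj₂ q with ∈-++⁻ (closings m _ s) q
  ... | inj₁ q′ = closing s q′
    where
    closing : ∀ s → a ∷ w ∈ closings m (ℕ.<⇒≤ le) s → WordStep le s a w
    closing (t ∷ s) q with ∈-map∷ q
    ... | refl , w∈ = close refl w∈
  ... | inj₂ q′ with ∈-++⁻ (List.map (fromℕ< le ∷_) (labellings m _ s)) q′
  ... | inj₁ q″ = let e , w∈ = ∈-map∷ q″ in singleton e w∈
  ... | inj₂ q″ = let e , w∈ = ∈-map∷ q″ in opener e w∈

  Step⇒∈ : ∀ m .(le : m ℕ.< n) s {a w} → WordStep le s a w → a ∷ w ∈ labellings (suc m) le s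
  Step⇒∈ m le s (continue a∈ w∈) = ∈-++⁺ˡ (∈-cartesianProductWith⁺ _∷_ a∈ w∈)
  Step⇒∈ m le s (close refl w∈)   =
    ∈-++⁺ʳ (cartesianProductWith _∷_ s (labellings m _ s)) (∈-++⁺ˡ (∈-map⁺ (_ ∷_) w∈))
  Step⇒∈ m le s (singleton refl w∈) =
    ∈-++⁺ʳ (cartesianProductWith _∷_ s _) (∈-++⁺ʳ (closings m _ s) (∈-++⁺ˡ (∈-map⁺ _ w∈)))
  Step⇒∈ m le s (opener refl w∈) =
    ∈-++⁺ʳ (cartesianProductWith _∷_ s _) (∈-++⁺ʳ (closings m _ s)
      (∈-++⁺ʳ (List.map (fromℕ< le ∷_) (labellings m _ s)) (∈-map⁺ _ w∈)))

  record Ordered (m : ℕ) (s : List (Fin n)) : Set where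
    constructor ordered
    field
      above  : All (λ a → m ℕ.≤ toℕ a) s
      sorted : AllPairs _≺_ s

  ordered-zero : Ordered n []
  ordered-zero = ordered [] []

  ordered-same : ∀ {s} → Ordered (suc m) s → Ordered m s
  ordered-same (ordered ab so) = ordered (All.map ℕ.<⇒≤ ab) so

  ordered-close : ∀ {t s} → Ordered (suc m) (t ∷ s) → Ordered m s
  ordered-close (ordered (_ ∷ ab) (_ ∷ so)) = ordered (All.map ℕ.<⇒≤ ab) so

  ordered-open : ∀ .(le : m ℕ.< n) {s} → Ordered (suc m) s → Ordered m (insert (fromℕ< le) s)
  ordered-open {m = m} le {s} (ordered ab so) = ordered (All.tabulate ab′) (insert-sorted ab″ so)
    where
    ab″ : All (fromℕ< le <_) s
    ab″ = All.map (subst (ℕ._< _) (sym (Fin.toℕ-fromℕ< le))) ab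
    ab′ : ∀ {a} → a ∈ insert (fromℕ< le) s → m ℕ.≤ toℕ a
    ab′ a∈ with ∈-insert⁻ s a∈
    ... | inj₁ refl = ℕ.≤-reflexive (sym (Fin.toℕ-fromℕ< le))
    ... | inj₂ a∈s  = ℕ.<⇒≤ (All.lookup ab a∈s)

  LabelBelow : ℕ → List (Fin n) → (Fin n → Fin n) → Fin n → Set
  LabelBelow m s r x = r x ∈ s ⊎ (toℕ (r x) ℕ.< m × x ≤ r x × r (r x) ≡ r x)

  Used : ℕ → (Fin n → Fin n) → Fin n → Set
  Used m r a = ∃[ x ] toℕ x ℕ.< m × r x ≡ a

  -- The meaning of membership in `labellings m le s`. The field `used` says that every open block
  -- still has an element to come, at the latest its minimum; `disc` is the field `disciplined` of
  -- `Valid` for `y` below `m`. With `m = n` and `s` empty this is `Valid`.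
  record Consistent (m : ℕ) (s : List (Fin n)) (r : Fin n → Fin n) : Set where
    field
      labels : ∀ {x} → toℕ x ℕ.< m → LabelBelow m s r x
      used   : ∀ {a} → a ∈ s → Used m r a
      disc   : ∀ {x y} → toℕ y ℕ.< m → x < y → y < r x → y < r y → r x ≺ r y →
               ∃[ z ] z < y × r z ≡ r y

  module _ {m} .(le : m ℕ.< n) {s : List (Fin n)} (i : Ordered (suc m) s)
           (r : Fin n → Fin n) where
    private
      p : Fin n
      p = fromℕ< le
      p≡m : toℕ p ≡ m
      p≡m = Fin.toℕ-fromℕ< le
      <p : ∀ {x : Fin n} → toℕ x ℕ.< m → x < p
      <p = subst (_ ℕ.<_) (sym p≡m)
      p<1+m : toℕ p ℕ.< suc m
      p<1+m = s≤s (ℕ.≤-reflexive p≡m)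
      p∉s : p ∉ s
      p∉s p∈s = ℕ.<⇒≢ (All.lookup (Ordered.above i) p∈s) (sym p≡m)
      weaken : ∀ {x : Fin n} → toℕ x ℕ.< m → toℕ x ℕ.< suc m
      weaken = ℕ.m<n⇒m<1+n

    consistent-continue : r p ∈ s → Consistent m s r → Consistent (suc m) s r
    consistent-continue rp∈s S = record { labels = labels ; used = used ; disc = disc }
      where
      module S = Consistent S
      labels : ∀ {x} → toℕ x ℕ.< suc m → LabelBelow (suc m) s r x
      labels x< with split-< le x<
      ... | inj₁ refl = inj₁ rp∈s
      ... | inj₂ x<m with S.labels x<m
      ... | inj₁ q       = inj₁ q
      ... | inj₂ (q , t) = inj₂ (weaken q , t)
      used : ∀ {a} → a ∈ s → Used (suc m) r a
      used a∈ = let x , x< , e = S.used a∈ in x , weaken x< , e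
      disc : ∀ {x y} → toℕ y ℕ.< suc m → x < y → y < r x → y < r y → r x ≺ r y →
             ∃[ z ] z < y × r z ≡ r y
      disc y< x<y y<rx y<ry rx≺ry with split-< le y<
      ... | inj₂ y<m  = S.disc y<m x<y y<rx y<ry rx≺ry
      -- The label of `p` stays in `s`, so it recurs below: `p` does not close its block.
      ... | inj₁ refl = let z , z< , e = S.used rp∈s in z , <p z< , e

    consistent-close : ∀ {s′} → s ≡ r p ∷ s′ → Consistent m s′ r → Consistent (suc m) s r
    consistent-close {s′} refl S = record { labels = labels ; used = used ; disc = disc }
      where
      module S = Consistent S
      labels : ∀ {x} → toℕ x ℕ.< suc m → LabelBelow (suc m) s r x
      labels x< with split-< le x<
      ... | inj₁ refl = inj₁ (here refl)
      ... | inj₂ x<m with S.labels x<m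
      ... | inj₁ q       = inj₁ (there q)
      ... | inj₂ (q , t) = inj₂ (weaken q , t)
      used : ∀ {a} → a ∈ s → Used (suc m) r a
      used (here refl) = p , p<1+m , refl
      used (there a∈)  = let x , x< , e = S.used a∈ in x , weaken x< , e
      disc : ∀ {x y} → toℕ y ℕ.< suc m → x < y → y < r x → y < r y → r x ≺ r y →
             ∃[ z ] z < y × r z ≡ r y
      disc {x} y< x<y y<rx y<ry rx≺ry with split-< le y<
      ... | inj₂ y<m = S.disc y<m x<y y<rx y<ry rx≺ry
      ... | inj₁ refl with S.labels (subst (toℕ x ℕ.<_) p≡m x<y)
      -- If the block of `x` is open, its label lies behind the head `r p` and cannot precede it;
      -- otherwise its label is below `p`, against `y<rx`.
      ... | inj₁ q = ⊥-elim (asym rx≺ry (All.lookup (AllPairs.head (Ordered.sorted i)) q))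
      ... | inj₂ (q , _) = ⊥-elim (ℕ.<-asym y<rx (<p q))

    -- Serves a singleton, with `s′` equal to `s`, and an opening element, with `s′` equal to
    -- `insert p s`. The discipline is void at `p`, because `r p ≡ p` rules out `p < r p`.
    consistent-new : ∀ {s′} → (∀ {a} → a ∈ s → a ∈ s′) → (∀ {a} → a ∈ s′ → a ≡ p ⊎ a ∈ s) →
      r p ≡ p → Consistent m s′ r → Consistent (suc m) s r
    consistent-new {s′} s⊆ s′⊆ rp≡p S = record { labels = labels ; used = used ; disc = disc }
      where
      module S = Consistent S
      labels : ∀ {x} → toℕ x ℕ.< suc m → LabelBelow (suc m) s r x
      labels {x} x< with split-< le x<
      ... | inj₁ refl rewrite rp≡p = inj₂ (p<1+m , ℕ.≤-refl , rp≡p)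
      ... | inj₂ x<m with S.labels x<m
      ... | inj₂ (q , t) = inj₂ (weaken q , t)
      ... | inj₁ q with s′⊆ q
      ... | inj₂ q′ = inj₁ q′
      ... | inj₁ e rewrite e = inj₂ (p<1+m , ℕ.<⇒≤ (<p x<m) , rp≡p)
      used : ∀ {a} → a ∈ s → Used (suc m) r a
      used a∈ = let x , x< , e = S.used (s⊆ a∈) in x , weaken x< , e
      disc : ∀ {x y} → toℕ y ℕ.< suc m → x < y → y < r x → y < r y → r x ≺ r y →
             ∃[ z ] z < y × r z ≡ r y
      disc y< x<y y<rx y<ry rx≺ry with split-< le y<
      ... | inj₂ y<m = S.disc y<m x<y y<rx y<ry rx≺ry
      ... | inj₁ refl = ⊥-elim (ℕ.<⇒≢ y<ry (cong toℕ (sym rp≡p)))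

    module _ (S : Consistent (suc m) s r) where
      private
        module S = Consistent S

        below : ∀ {x} → toℕ x ℕ.< m → r x ≢ p → LabelBelow m s r x
        below x<m rx≢p with S.labels (weaken x<m)
        ... | inj₁ q = inj₁ q
        ... | inj₂ (q , t) with split-< le q
        ... | inj₁ e = contradiction e rx≢p
        ... | inj₂ q′ = inj₂ (q′ , t)

        idem : ∀ {x} → toℕ x ℕ.< m → r x ≡ p → r p ≡ p
        idem x<m rx≡p with S.labels (weaken x<m)
        ... | inj₁ q = contradiction (subst (_∈ s) rx≡p q) p∉s
        ... | inj₂ (_ , _ , e) = trans (cong r (sym rx≡p)) (trans e rx≡p)

        disc : ∀ {x y} → toℕ y ℕ.< m → x < y → y < r x → y < r y → r x ≺ r y →
               ∃[ z ] z < y × r z ≡ r y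
        disc y<m = S.disc (weaken y<m)

      -- Converse of `consistent-new`, again for both cases. The hypotheses `p∈` and `p-used` make
      -- `p` a member of `s′` exactly when it is used as a label below `m`.
      unstep-new : ∀ {s′} → (∀ {a} → a ∈ s → a ∈ s′) → (∀ {a} → a ∈ s′ → a ≡ p ⊎ a ∈ s) →
        (∀ {x} → toℕ x ℕ.< m → r x ≡ p → p ∈ s′) → (p ∈ s′ → Used m r p) →
        r p ≡ p → Consistent m s′ r
      unstep-new {s′} s⊆ s′⊆ p∈ p-used rp≡p =
        record { labels = labels ; used = used ; disc = disc }
        where
        labels : ∀ {x} → toℕ x ℕ.< m → LabelBelow m s′ r x
        labels {x} x<m with r x Fin.≟ p
        ... | yes e = inj₁ (subst (_∈ s′) (sym e) (p∈ x<m e))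
        ... | no ne with below x<m ne
        ... | inj₁ q = inj₁ (s⊆ q)
        ... | inj₂ q = inj₂ q
        used : ∀ {a} → a ∈ s′ → Used m r a
        used a∈ with s′⊆ a∈
        ... | inj₁ refl = p-used a∈
        ... | inj₂ a∈s with S.used a∈s
        ... | x , x< , e with split-< le x<
        ... | inj₂ x<m = x , x<m , e
        ... | inj₁ refl = contradiction (subst (_∈ s) (trans (sym e) rp≡p) a∈s) p∉s

      -- Serves a continuing element, with `s′` equal to `s`, and a closing one, with `s′` the tail
      -- of `s`. Only the membership of `r p` in `s′` depends on the case.
      unstep-old : ∀ {s′} → (∀ {a} → a ∈ s → a ≡ r p ⊎ a ∈ s′) → (∀ {a} → a ∈ s′ → a ∈ s) →
        (∀ {x} → toℕ x ℕ.< m → r x ≡ r p → r p ∈ s′) →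
        (r p ∈ s′ → Used m r (r p)) →
        r p ≢ p → Consistent m s′ r
      unstep-old {s′} s⊆ s′⊆ rp∈ rp-used rp≢p =
        record { labels = labels ; used = used ; disc = disc }
        where
        labels : ∀ {x} → toℕ x ℕ.< m → LabelBelow m s′ r x
        labels {x} x<m with below x<m (rp≢p ∘ idem x<m)
        ... | inj₂ q = inj₂ q
        ... | inj₁ q with s⊆ q
        ... | inj₁ e  = inj₁ (subst (_∈ s′) (sym e) (rp∈ x<m e))
        ... | inj₂ q′ = inj₁ q′
        used : ∀ {a} → a ∈ s′ → Used m r a
        used a∈ with S.used (s′⊆ a∈)
        ... | x , x< , e with split-< le x<
        ... | inj₂ x<m = x , x<m , e
        ... | inj₁ refl = let x′ , x′< , e′ = rp-used (subst (_∈ s′) (sym e) a∈)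
                          in x′ , x′< , trans e′ e

      private
        reused? : ∀ a → Dec (Used m r a)
        reused? a = Fin.any? λ x → (toℕ x ℕ.<? m) ×-dec (r x Fin.≟ a)

      -- The label of `p` is new or inherited, and it recurs below `m` or does not; the four
      -- combinations are the four constructors of `Step`. Only an inherited label that does not
      -- recur calls on the discipline, which makes it the head of `s`.
      unstep : Step le (λ s → Consistent m s r) s (r p)
      unstep with S.labels p<1+m | reused? (r p)
      ... | inj₂ (q , p≤rp , e) | d = new d
        where
        rp≡p : r p ≡ p
        rp≡p = Fin.≤-antisym (subst (toℕ (r p) ℕ.≤_) (sym p≡m) (ℕ.s≤s⁻¹ q)) p≤rp
        new : Dec (Used m r (r p)) → Step le (λ s → Consistent m s r) s (r p)
        new (yes (x , x<m , e)) = opener rp≡p (unstep-new ∈-insert⁺ʳ (∈-insert⁻ s)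
          (λ _ _ → ∈-insert⁺ˡ s) (λ _ → x , x<m , trans e rp≡p) rp≡p)
        new (no ¬reused) = singleton rp≡p (unstep-new id inj₂
          (λ x<m e → contradiction (_ , x<m , trans e (sym rp≡p)) ¬reused)
          (λ p∈s → contradiction p∈s p∉s) rp≡p)
      ... | inj₁ rp∈s | yes reused = continue rp∈s
        (unstep-old inj₂ id (λ _ _ → rp∈s) (λ _ → reused) (λ e → p∉s (subst (_∈ s) e rp∈s)))
      ... | inj₁ rp∈s | no ¬reused = old refl rp∈s
        where
        old : ∀ {s₀} → s₀ ≡ s → r p ∈ s₀ → Step le (λ s → Consistent m s r) s (r p)
        old {t ∷ s′} refl (here e) = close (cong (_∷ s′) (sym e)) (unstep-old
          (λ { (here a≡t) → inj₁ (trans a≡t (sym e)) ; (there q) → inj₂ q }) there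
          (λ x<m e′ → contradiction (_ , x<m , e′) ¬reused)
          (λ q → ⊥-elim (irrefl (sym e) (All.lookup (AllPairs.head (Ordered.sorted i)) q)))
          (λ e → p∉s (subst (_∈ s) e rp∈s)))
        -- Suppose that `r p` lies behind the head `t`. Some `x` carries the label `t`, and `x` is
        -- not `p`, so `x < p < t` with `t ≺ r p`. The discipline then yields an element below `p`
        -- with label `r p`, contrary to `¬reused`.
        old {t ∷ s′} refl (there q) with S.used (here refl)
        ... | x , x< , rx≡t with split-< le x< | All.lookup (AllPairs.head (Ordered.sorted i)) q
        ... | inj₁ refl | t≺rp = ⊥-elim (irrefl (sym rx≡t) t≺rp)
        ... | inj₂ x<m  | t≺rp = ⊥-elim (¬reused (let z , z<p , e = reuse in
                z , subst (toℕ z ℕ.<_) p≡m z<p , e))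
          where
          reuse : ∃[ z ] z < p × r z ≡ r p
          reuse = S.disc p<1+m (<p x<m)
            (subst (ℕ._< toℕ (r x)) (sym p≡m) (All.lookup (Ordered.above i) (here rx≡t)))
            (subst (ℕ._< toℕ (r p)) (sym p≡m) (All.lookup (Ordered.above i) rp∈s))
            (subst (_≺ r p) (sym rx≡t) t≺rp)

  Consistent⇒∈ : ∀ m .(le : m ℕ.≤ n) {s} → Ordered m s → ∀ r → Consistent m s r →
    word r m le ∈ labellings m le s
  Consistent⇒∈ zero    le {[]}    i r S = here refl
  Consistent⇒∈ zero    le {_ ∷ _} i r S with () ← proj₁ (proj₂ (Consistent.used S (here refl)))
  Consistent⇒∈ (suc m) le {s}     i r S = Step⇒∈ m le s (step (unstep le i r S))
    where
    step : Step le (λ s → Consistent m s r) s (r (fromℕ< le)) →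
      WordStep le s (r (fromℕ< le)) (word r m (ℕ.<⇒≤ le))
    step (continue a∈ S′) = continue a∈ (Consistent⇒∈ m _ (ordered-same i) r S′)
    step (close refl S′)  = close refl (Consistent⇒∈ m _ (ordered-close i) r S′)
    step (singleton e S′) = singleton e (Consistent⇒∈ m _ (ordered-same i) r S′)
    step (opener e S′)     = opener e (Consistent⇒∈ m _ (ordered-open le i) r S′)

  ∈⇒Consistent : ∀ m .(le : m ℕ.≤ n) {s} → Ordered m s → ∀ r →
    word r m le ∈ labellings m le s → Consistent m s r
  ∈⇒Consistent zero    le {[]} i r _ = record { labels = λ () ; used = λ () ; disc = λ () }
  ∈⇒Consistent (suc m) le {s}  i r w∈ with ∈⇒Step m le s w∈
  ... | continue a∈ w∈′  = consistent-continue le i r a∈ (∈⇒Consistent m _ (ordered-same i) r w∈′)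
  ... | close refl w∈′   = consistent-close le i r refl (∈⇒Consistent m _ (ordered-close i) r w∈′)
  ... | singleton e w∈′  =
    consistent-new le i r id inj₂ e (∈⇒Consistent m _ (ordered-same i) r w∈′)
  ... | opener e w∈′      =
    consistent-new le i r ∈-insert⁺ʳ (∈-insert⁻ s) e (∈⇒Consistent m _ (ordered-open le i) r w∈′)

  ∈⇒Consistent-label : ∀ .(le : m ℕ.≤ n) {s} → Ordered m s → ∀ {w} → w ∈ labellings m le s →
    Consistent m s (label w)
  ∈⇒Consistent-label le i {w} w∈ =
    ∈⇒Consistent _ le i (label w) (subst (_∈ labellings _ le _) (sym (word-label w le)) w∈)

  -- By `used`, some `x` below `m` carries the label `a`. As `a` is not in `s′`, it would have to be
  -- below `m`, whereas `Ordered` places it at or above `m`.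
  Consistent-separates : ∀ {s s′ r a} → Ordered m s → a ∈ s → a ∉ s′ → Consistent m s r →
    Consistent m s′ r → ⊥
  Consistent-separates i a∈ a∉ S S′ with Consistent.used S a∈
  ... | x , x<m , refl with Consistent.labels S′ x<m
  ... | inj₁ q       = a∉ q
  ... | inj₂ (q , _) = ℕ.<⇒≱ q (All.lookup (Ordered.above i) a∈)

  -- The first letter, inherited or equal to `p`, separates continuing and closing from singleton
  -- and opening. Within each pair the rest of the word decides, by `Consistent-separates`: applied
  -- to the head of `s` in the first pair and to `p` in the second.
  labellings-unique : ∀ m .(le : m ℕ.≤ n) {s} → Ordered m s → Unique (labellings m le s)
  labellings-unique zero    le {[]}    i = [] ∷ []
  labellings-unique zero    le {_ ∷ _} i = []
  labellings-unique (suc m) le {s}     i =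
    Unique.++⁺ (Unique.cartesianProductWith⁺ _∷_ ∷-≡ s! same!)
      (Unique.++⁺ (closings! i)
        (Unique.++⁺ (Unique.map⁺ Vec.∷-injectiveʳ same!)
                    (Unique.map⁺ Vec.∷-injectiveʳ (labellings-unique m _ (ordered-open le i)))
                    (λ { {a ∷ w} (q , q′) → sep-open (proj₂ (∈-map∷ q)) (proj₂ (∈-map∷ q′)) }))
        (λ { {a ∷ w} (q , q′) → p∉s (subst (_∈ s)
          (new-head (labellings m _ s) _ q′) (∈-closings i q)) }))
      (λ { {a ∷ w} (q , q′) → first-disjoint (labellings m _ s) _ q q′ })
    where
    p : Fin n
    p = fromℕ< le
    same! : Unique (labellings m (ℕ.<⇒≤ le) s)
    same! = labellings-unique m _ (ordered-same i)
    p∉s : p ∉ s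
    p∉s p∈s = ℕ.<⇒≢ (All.lookup (Ordered.above i) p∈s) (sym (Fin.toℕ-fromℕ< le))
    s! : Unique s
    s! = AllPairs.map (λ a≺b e → irrefl e a≺b) (Ordered.sorted i)
    closings! : ∀ {s} → Ordered (suc m) s → Unique (closings m (ℕ.<⇒≤ le) s)
    closings! {[]}    i = []
    closings! {t ∷ s} i = Unique.map⁺ Vec.∷-injectiveʳ (labellings-unique m _ (ordered-close i))
    ∈-closings : ∀ {s a w} → Ordered (suc m) s → a ∷ w ∈ closings m (ℕ.<⇒≤ le) s → a ∈ s
    ∈-closings {t ∷ s} i q = here (proj₁ (∈-map∷ q))
    sep-open : ∀ {w} → w ∈ labellings m (ℕ.<⇒≤ le) s →
      w ∈ labellings m (ℕ.<⇒≤ le) (insert p s) → ⊥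
    sep-open w∈ w∈′ = Consistent-separates (ordered-open le i) (∈-insert⁺ˡ s) p∉s
      (∈⇒Consistent-label _ (ordered-open le i) w∈′) (∈⇒Consistent-label _ (ordered-same i) w∈)
    new-head : ∀ {a w} ws ws′ → a ∷ w ∈ List.map (p ∷_) ws ++ List.map (p ∷_) ws′ → a ≡ p
    new-head ws ws′ q with ∈-++⁻ (List.map (p ∷_) ws) q
    ... | inj₁ q′ = proj₁ (∈-map∷ q′)
    ... | inj₂ q′ = proj₁ (∈-map∷ q′)
    sep-close : ∀ {s a w} → Ordered (suc m) s → w ∈ labellings m (ℕ.<⇒≤ le) s →
      a ∷ w ∈ closings m (ℕ.<⇒≤ le) s → ⊥
    sep-close {t ∷ s} i w∈ q = Consistent-separates (ordered-same i) (here refl)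
      (λ t∈s → irrefl refl (All.lookup (AllPairs.head (Ordered.sorted i)) t∈s))
      (∈⇒Consistent-label _ (ordered-same i) w∈)
      (∈⇒Consistent-label _ (ordered-close i) (proj₂ (∈-map∷ q)))
    first-disjoint : ∀ {a w} ws ws′ →
      a ∷ w ∈ cartesianProductWith _∷_ s (labellings m (ℕ.<⇒≤ le) s) →
      a ∷ w ∈ closings m (ℕ.<⇒≤ le) s ++ List.map (p ∷_) ws ++ List.map (p ∷_) ws′ → ⊥
    first-disjoint ws ws′ q q′ with ∈-cartesianProductWith⁻ _∷_ s _ q
    ... | _ , _ , a∈ , w∈ , refl with ∈-++⁻ (closings m _ s) q′
    ... | inj₁ q″ = sep-close i w∈ q″
    ... | inj₂ q″ = p∉s (subst (_∈ s) (new-head ws ws′ q″) a∈)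

  Consistent⇒Valid : ∀ {r} → Consistent n [] r → Valid D r
  Consistent⇒Valid {r} S = record
    { inflationary = λ x → proj₁ (proj₂ (lab x))
    ; idempotent   = λ x → proj₂ (proj₂ (lab x))
    ; disciplined  = λ {x} {y} → Consistent.disc S (Fin.toℕ<n y)
    }
    where
    lab : ∀ x → toℕ (r x) ℕ.< n × x ≤ r x × r (r x) ≡ r x
    lab x with Consistent.labels S (Fin.toℕ<n x)
    ... | inj₂ q = q

  Valid⇒Consistent : ∀ {r} → Valid D r → Consistent n [] r
  Valid⇒Consistent v = record
    { labels = λ {x} _ → inj₂ (Fin.toℕ<n _ , Valid.inflationary v x , Valid.idempotent v x)
    ; used   = λ ()
    ; disc   = λ _ → Valid.disciplined v
    }

  -- One application of `length-≤` in each direction, through the word of a labelling. Labellings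
  -- are compared pointwise, words by `≡`.
  length-by-labels : (R : A → (Fin n → Fin n) → Set) {xs : List A} → Unique xs →
    (∀ {x} → x ∈ xs → ∃[ r ] Valid D r × R x r) →
    (∀ {r} → Valid D r → ∃[ x ] x ∈ xs × R x r) →
    (∀ {x r r′} → x ∈ xs → R x r → R x r′ → ∀ i → r i ≡ r′ i) →
    (∀ {x x′ r r′} → x ∈ xs → x′ ∈ xs → R x r → R x′ r′ → (∀ i → r i ≡ r′ i) → x ≡ x′) →
    length xs ≡ length (labellings n ℕ.≤-refl [])
  length-by-labels R {xs} xs! lab obj fun inj = ℕ.≤-antisym
    (length-≤ T xs!
      (λ x∈ → let r , v , Rxr = lab x∈ in
        word r n ℕ.≤-refl ,
        Consistent⇒∈ n ℕ.≤-refl ordered-zero r (Valid⇒Consistent v) , r , Rxr ,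
        λ i → label-word r n ℕ.≤-refl i (Fin.toℕ<n i))
      (λ { x∈ x′∈ (r , Rxr , e) (r′ , Rx′r′ , e′) →
        inj x∈ x′∈ Rxr Rx′r′ (λ i → trans (sym (e i)) (e′ i)) }))
    (length-≤ (λ w x → x ∈ xs × T x w) (labellings-unique n ℕ.≤-refl ordered-zero)
      (λ {w} w∈ →
        let v = Consistent⇒Valid (∈⇒Consistent-label ℕ.≤-refl ordered-zero w∈)
            x , x∈ , Rx = obj v in
        x , x∈ , x∈ , label w , Rx , λ i → refl)
      (λ { {w} {w′} _ _ (x∈ , r , Rxr , e) (_ , r′ , Rxr′ , e′) →
        trans (sym (word-label w ℕ.≤-refl))
          (trans (word-cong n _ λ i _ → trans (e i) (trans (fun x∈ Rxr Rxr′ i) (sym (e′ i))))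
                 (word-label w′ ℕ.≤-refl)) }))
    where
    T : _ → Vec (Fin n) n → Set
    T x w = ∃[ r ] R x r × (∀ i → label w i ≡ r i)

-- Independence of the discipline

module _ (D D′ : Discipline n) where
  private
    module L  = Labellings D
    module L′ = Labellings D′
    module D  = Discipline D
    module D′ = Discipline D′

  private
    length-++-cong : ∀ (as bs : List A) {cs ds} → length as ≡ length bs → length cs ≡ length ds →
      length (as ++ cs) ≡ length (bs ++ ds)
    length-++-cong as bs e e′ =
      trans (List.length-++ as) (trans (cong₂ _+_ e e′) (sym (List.length-++ bs)))

    length-map-cong : ∀ (f g : A → B) as bs → length as ≡ length bs →
      length (List.map f as) ≡ length (List.map g bs)
    length-map-cong f g as bs e = trans (List.length-map f as) (trans e (sym (List.length-map g bs)))

  -- The recursion sees `s` only through its length: there are `length s` ways to continue, one way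
  -- to close if `s` is nonempty, and `insert` adds one label whatever its place.
  labellings-length : ∀ m .(le : m ℕ.≤ n) s s′ → length s ≡ length s′ →
    length (L.labellings m le s) ≡ length (L′.labellings m le s′)
  labellings-length zero    le []      []       e = refl
  labellings-length zero    le (_ ∷ _) (_ ∷ _)  e = refl
  labellings-length (suc m) le s       s′       e =
    length-++-cong (cartesianProductWith _∷_ s _) (cartesianProductWith _∷_ s′ _)
      (trans (length-cartesianProductWith _∷_ s _)
        (trans (cong₂ _*_ e (below s s′ e)) (sym (length-cartesianProductWith _∷_ s′ _))))
      (length-++-cong (L.closings m _ s) (L′.closings m _ s′) (closings-length s s′ e)
        (length-++-cong (List.map (p ∷_) (L.labellings m _ s)) (List.map (p ∷_) (L′.labellings m _ s′))
          (labelled-length p p s s′ e)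
          (labelled-length p p (D.insert p s) (D′.insert p s′)
            (trans (D.length-insert p s) (trans (cong suc e) (sym (D′.length-insert p s′)))))))
    where
    p : Fin n
    p = fromℕ< le
    below : ∀ s s′ → length s ≡ length s′ →
      length (L.labellings m (ℕ.<⇒≤ le) s) ≡ length (L′.labellings m (ℕ.<⇒≤ le) s′)
    below = labellings-length m _
    labelled-length : ∀ a a′ s s′ → length s ≡ length s′ →
      length (List.map (a Vec.∷_) (L.labellings m (ℕ.<⇒≤ le) s))
        ≡ length (List.map (a′ Vec.∷_) (L′.labellings m (ℕ.<⇒≤ le) s′))
    labelled-length a a′ s s′ e =
      length-map-cong (a Vec.∷_) (a′ Vec.∷_) (L.labellings m _ s) (L′.labellings m _ s′) (below s s′ e)
    closings-length : ∀ s s′ → length s ≡ length s′ →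
      length (L.closings m (ℕ.<⇒≤ le) s) ≡ length (L′.closings m (ℕ.<⇒≤ le) s′)
    closings-length []      []        e = refl
    closings-length (t ∷ s) (t′ ∷ s′) e = labelled-length t t′ s s′ (ℕ.suc-injective e)

-- The two disciplines

stack : ∀ n → Discipline n
stack n = record
  { _≺_           = _<_
  ; asym          = ℕ.<-asym
  ; insert        = _∷_
  ; length-insert = λ p s → refl
  ; ∈-insert⁺ˡ    = λ s → here refl
  ; ∈-insert⁺ʳ    = there
  ; ∈-insert⁻     = λ { s (here e) → inj₁ e ; s (there q) → inj₂ q }
  ; insert-sorted = _∷_
  }

-- Labels arrive in decreasing order, so appending keeps the list decreasing with the longest open
-- block at its head. In `stack`, prepending keeps it increasing with the latest block at its head.
queue : ∀ n → Discipline n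
queue n = record
  { _≺_           = λ a b → b < a
  ; asym          = ℕ.<-asym
  ; insert        = λ p s → s ++ [ p ]
  ; length-insert = λ p s → trans (List.length-++-comm s [ p ]) refl
  ; ∈-insert⁺ˡ    = λ s → ∈-++⁺ʳ s (here refl)
  ; ∈-insert⁺ʳ    = ∈-++⁺ˡ
  ; ∈-insert⁻     = λ s q → last s (∈-++⁻ s q)
  ; insert-sorted = λ p<s so → AllPairs.++⁺ so ([] ∷ []) (All.map (_∷ []) p<s)
  }
  where
  last : ∀ {p a} (s : List (Fin n)) → a ∈ s ⊎ a ∈ [ p ] → a ≡ p ⊎ a ∈ s
  last s (inj₁ q)        = inj₂ q
  last s (inj₂ (here e)) = inj₁ e

-- Non-overlapping partitions

∈-words : ∀ {as : List A} → (∀ a → a ∈ as) → (w : Vec A m) → w ∈ words as m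
∈-words all []      = here refl
∈-words all (a ∷ w) = ∈-cartesianProductWith⁺ _∷_ (all a) (∈-words all w)

words-unique : ∀ {as : List A} m → Unique as → Unique (words as m)
words-unique zero    as! = [] ∷ []
words-unique (suc m) as! = Unique.cartesianProductWith⁺ _∷_ ∷-≡ as! (words-unique m as!)

∈-sublists-∷⁻ : ∀ {x : A} {us} xs → us ∈ sublists (x ∷ xs) →
  (∃[ vs ] vs ∈ sublists xs × us ≡ x ∷ vs) ⊎ us ∈ sublists xs
∈-sublists-∷⁻ xs p with ∈-++⁻ (List.map (_ ∷_) (sublists xs)) p
... | inj₁ q = inj₁ (∈-map⁻ _ q)
... | inj₂ q = inj₂ q

sublists-⊆ : ∀ {us} (xs : List A) → us ∈ sublists xs → ∀ {a} → a ∈ us → a ∈ xs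
sublists-⊆ []       (here refl) ()
sublists-⊆ (x ∷ xs) p a∈ with ∈-sublists-∷⁻ xs p
... | inj₂ q = there (sublists-⊆ xs q a∈)
sublists-⊆ (x ∷ xs) p (here refl) | inj₁ (vs , q , refl) = here refl
sublists-⊆ (x ∷ xs) p (there a∈)  | inj₁ (vs , q , refl) = there (sublists-⊆ xs q a∈)

sublists-unique : ∀ {xs : List A} → Unique xs → Unique (sublists xs)
sublists-unique {xs = []}     _ = [] ∷ []
sublists-unique {xs = x ∷ xs} x∷xs! = Unique.++⁺
  (Unique.map⁺ List.∷-injectiveʳ (sublists-unique (AllPairs.tail x∷xs!)))
  (sublists-unique (AllPairs.tail x∷xs!)) disjoint
  where
  disjoint : ∀ {us} → us ∈ List.map (x ∷_) (sublists xs) × us ∈ sublists xs → ⊥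
  disjoint (p , q) with ∈-map⁻ _ p
  ... | vs , _ , refl = Unique-head x∷xs! (sublists-⊆ xs q (here refl))

-- Both lists begin with `x` or neither does, because `x` does not occur in `xs`. Families can thus
-- be compared as sets.
sublists-ext : ∀ {us vs} {xs : List A} → Unique xs → us ∈ sublists xs → vs ∈ sublists xs →
  (∀ {a} → a ∈ us → a ∈ vs) → (∀ {a} → a ∈ vs → a ∈ us) → us ≡ vs
sublists-ext {xs = []}     _ (here refl) (here refl) _ _ = refl
sublists-ext {xs = x ∷ xs} x∷xs! p q us⊆ vs⊆ with ∈-sublists-∷⁻ xs p | ∈-sublists-∷⁻ xs q
... | inj₂ p′ | inj₂ q′ = sublists-ext (AllPairs.tail x∷xs!) p′ q′ us⊆ vs⊆
... | inj₁ (us , p′ , refl) | inj₂ q′ =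
  contradiction (sublists-⊆ xs q′ (us⊆ (here refl))) (Unique-head x∷xs!)
... | inj₂ p′ | inj₁ (vs , q′ , refl) =
  contradiction (sublists-⊆ xs p′ (vs⊆ (here refl))) (Unique-head x∷xs!)
... | inj₁ (us , p′ , refl) | inj₁ (vs , q′ , refl) =
  cong (x ∷_) (sublists-ext (AllPairs.tail x∷xs!) p′ q′ (strip p′ us⊆) (strip q′ vs⊆))
  where
  strip : ∀ {us vs} → us ∈ sublists xs → (∀ {a} → a ∈ x ∷ us → a ∈ x ∷ vs) → ∀ {a} →
    a ∈ us → a ∈ vs
  strip p ⊆ a∈ with ⊆ (there a∈)
  ... | here refl = contradiction (sublists-⊆ xs p a∈) (Unique-head x∷xs!)
  ... | there q   = q

filter-∈-sublists : ∀ {P : A → Set} (P? : Decidable P) xs → filter P? xs ∈ sublists xs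
filter-∈-sublists P? []       = here refl
filter-∈-sublists P? (x ∷ xs) with P? x
... | yes _ = ∈-++⁺ˡ (∈-map⁺ _ (filter-∈-sublists P? xs))
... | no  _ = ∈-++⁺ʳ (List.map (x ∷_) (sublists xs)) (filter-∈-sublists P? xs)

greatest : ∀ {P : Fin n → Set} → Decidable P → ∃ P → ∃[ a ] P a × (∀ x → P x → x ≤ a)
greatest {n = suc n} P? (i , Pi) with Fin.any? (P? ∘ suc)
greatest {n = suc n} P? _ | yes sucs with greatest (P? ∘ suc) sucs
... | a , Pa , max = suc a , Pa , λ { zero _ → z≤n ; (suc x) Px → s≤s (max x Px) }
greatest {n = suc n} P? (suc i , Pi) | no ¬sucs = contradiction (i , Pi) ¬sucs
greatest {n = suc n} P? (zero  , P0) | no ¬sucs =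
  zero , P0 , λ { zero _ → z≤n ; (suc x) Px → contradiction (x , Px) ¬sucs }

least : ∀ {P : Fin n → Set} → Decidable P → ∃ P → ∃[ a ] P a × (∀ x → P x → a ≤ x)
least {n = suc n} P? (i , Pi) with P? zero
least {n = suc n} P? _            | yes P0 = zero , P0 , λ _ _ → z≤n
least {n = suc n} P? (zero  , P0) | no ¬P0 = contradiction P0 ¬P0
least {n = suc n} P? (suc i , Pi) | no ¬P0 with least (P? ∘ suc) (i , Pi)
... | a , Pa , min =
  suc a , Pa , λ { zero P0 → contradiction P0 ¬P0 ; (suc x) Px → s≤s (min x Px) }

IsMax-unique : ∀ {A : Subset n} {a b} → IsMax A a → IsMax A b → a ≡ b
IsMax-unique (a∈ , max) (b∈ , max′) = Fin.≤-antisym (max′ _ a∈) (max _ b∈)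

MaxLabelling : List (Subset n) → (Fin n → Fin n) → Set
MaxLabelling P r = ∀ {A} → A ∈ P → ∀ {x} → x Subset.∈ A → IsMax A (r x)

module _ {P : List (Subset n)} (partition : IsSetPartition P) where
  private
    disjoint = proj₁ (proj₂ partition)
    cover = proj₂ (proj₂ partition)

  block-unique : ∀ {A B x} → A ∈ P → B ∈ P → x Subset.∈ A → x Subset.∈ B → A ≡ B
  block-unique {A} {B} A∈ B∈ x∈A x∈B with AllPairs-lookup disjoint A∈ B∈
  ... | inj₁ e = e
  ... | inj₂ (inj₁ e) = ⊥-elim (e (_ , Subset.x∈p∩q⁺ (x∈A , x∈B)))
  ... | inj₂ (inj₂ e) = ⊥-elim (e (_ , Subset.x∈p∩q⁺ (x∈B , x∈A)))

  block : ∀ x → ∃[ A ] A ∈ P × x Subset.∈ A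
  block x = find (cover x)

  maxLabelling : ∃[ r ] MaxLabelling P r
  maxLabelling = r , isMax
    where
    top : ∀ x → ∃[ a ] IsMax (proj₁ (block x)) a
    top x = greatest (Subset._∈? proj₁ (block x)) (x , proj₂ (proj₂ (block x)))
    r : Fin n → Fin n
    r x = proj₁ (top x)
    isMax : MaxLabelling P r
    isMax A∈ {x} x∈ with block-unique (proj₁ (proj₂ (block x))) A∈ (proj₂ (proj₂ (block x))) x∈
    ... | refl = proj₂ (top x)

  maxLabelling-functional : ∀ {r r′} → MaxLabelling P r → MaxLabelling P r′ → ∀ x → r x ≡ r′ x
  maxLabelling-functional R R′ x with block x
  ... | A , A∈ , x∈ = IsMax-unique (R A∈ x∈) (R′ A∈ x∈)

  same-label⇒same-block : ∀ {r A x y} → MaxLabelling P r → A ∈ P → x Subset.∈ A →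
    r y ≡ r x → y Subset.∈ A
  same-label⇒same-block {y = y} R A∈ x∈ e with block y
  ... | B , B∈ , y∈
    with block-unique A∈ B∈ (proj₁ (R A∈ x∈)) (subst (Subset._∈ B) e (proj₁ (R B∈ y∈)))
  ... | refl = y∈

  -- For the discipline: if nothing smaller shares the block of `y`, then `y` is its minimum. With
  -- `a` the minimum of the block of `x`, the chain `a < y < r x < r y` is an overlap.
  maxLabelling-valid : ∀ {r} → NonOverlapping P → MaxLabelling P r → Valid (stack n) r
  maxLabelling-valid {r} nonOverlapping R = record
    { inflationary = λ x → let A , A∈ , x∈ = block x in proj₂ (R A∈ x∈) x x∈
    ; idempotent   = λ x → let A , A∈ , x∈ = block x in
        IsMax-unique (R A∈ (proj₁ (R A∈ x∈))) (R A∈ x∈)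
    ; disciplined  = disciplined
    }
    where
    disciplined : ∀ {x y} → x < y → y < r x → y < r y → r x < r y → ∃[ z ] z < y × r z ≡ r y
    disciplined {x} {y} x<y y<rx _ rx<ry with Fin.any? (λ z → (z Fin.<? y) ×-dec (r z Fin.≟ r y))
    ... | yes q = q
    ... | no ¬q with block x | block y
    ... | A , A∈ , x∈ | B , B∈ , y∈ with least (Subset._∈? A) (x , x∈)
    ... | a , a∈ , min = ⊥-elim (All.lookup (All.lookup nonOverlapping A∈) B∈
      (a , y , r x , r y , ((a∈ , min) , (y∈ , y-min) , R A∈ x∈ , R B∈ y∈) ,
       ℕ.≤-<-trans (min x x∈) x<y , y<rx , rx<ry))
      where
      y-min : ∀ z → z Subset.∈ B → y ≤ z
      y-min z z∈ = ℕ.≮⇒≥ λ z<y → ¬q (z , z<y , IsMax-unique (R B∈ z∈) (R B∈ y∈))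

-- A block consists of all elements carrying its maximum as label, so it can be read off from the
-- labelling.
maxLabelling-⊆ : ∀ {P P′ : List (Subset n)} {r r′} → IsSetPartition P → IsSetPartition P′ →
  MaxLabelling P r → MaxLabelling P′ r′ → (∀ x → r x ≡ r′ x) → ∀ {A} → A ∈ P → A ∈ P′
maxLabelling-⊆ {P′ = P′} p p′ R R′ r≗r′ {A} A∈ with All.lookup (proj₁ p) A∈
... | x , x∈ with block p′ x
... | B , B∈ , x∈B = subst (_∈ P′) (Subset.⊆-antisym
  (λ {y} y∈B → same-label⇒same-block p R A∈ x∈
    (trans (r≗r′ y) (trans (IsMax-unique (R′ B∈ y∈B) (R′ B∈ x∈B)) (sym (r≗r′ x)))))
  (λ {y} y∈A → same-label⇒same-block p′ R′ B∈ x∈B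
    (trans (sym (r≗r′ y)) (trans (IsMax-unique (R A∈ y∈A) (R A∈ x∈)) (r≗r′ x))))) B∈

fibre : (Fin n → Fin n) → Fin n → Subset n
fibre r c = Vec.tabulate λ x → does (r x Fin.≟ c)

∈-fibre⁺ : ∀ (r : Fin n → Fin n) {x c} → r x ≡ c → x Subset.∈ fibre r c
∈-fibre⁺ r {x} {c} e = Vec.lookup⇒[]= x _
  (trans (Vec.lookup∘tabulate _ x) (dec-true (r x Fin.≟ c) e))

∈-fibre⁻ : ∀ (r : Fin n → Fin n) {x c} → x Subset.∈ fibre r c → r x ≡ c
∈-fibre⁻ r {x} {c} x∈ = does-true (r x Fin.≟ c)
  (trans (sym (Vec.lookup∘tabulate (λ x → does (r x Fin.≟ c)) x)) (Vec.[]=⇒lookup x∈))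

-- For idempotent `r`, the condition `r c ≡ c` selects the nonempty fibres.
IsFibre : (Fin n → Fin n) → Subset n → Set
IsFibre r A = ∃[ c ] r c ≡ c × A ≡ fibre r c

isFibre? : (r : Fin n → Fin n) → Decidable (IsFibre r)
isFibre? r A = Fin.any? λ c → (r c Fin.≟ c) ×-dec Vec.≡-dec Bool._≟_ A (fibre r c)

sides-complete : ∀ s → s ∈ inside ∷ outside ∷ []
sides-complete inside  = here refl
sides-complete outside = there (here refl)

subsets-unique : ∀ n → Unique (subsets n)
subsets-unique n = words-unique n (((λ ()) ∷ []) ∷ [] ∷ [])

fibres : (Fin n → Fin n) → List (Subset n)
fibres r = filter (isFibre? r) (subsets _)

module _ {r : Fin n → Fin n} (v : Valid (stack n) r) where
  open Valid v

  ∈-fibres⁻ : ∀ {A} → A ∈ fibres r → IsFibre r A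
  ∈-fibres⁻ A∈ = proj₂ (∈-filter⁻ (isFibre? r) {xs = subsets n} A∈)

  fibre∈fibres : ∀ x → fibre r (r x) ∈ fibres r
  fibre∈fibres x = ∈-filter⁺ (isFibre? r) (∈-words sides-complete _) (r x , idempotent x , refl)

  fibres-labelling : MaxLabelling (fibres r) r
  fibres-labelling A∈ x∈ with ∈-fibres⁻ A∈
  ... | c , rc≡c , refl with ∈-fibre⁻ r x∈
  ... | refl = ∈-fibre⁺ r rc≡c , λ y y∈ → subst (y ≤_) (∈-fibre⁻ r y∈) (inflationary y)

  fibres-partition : IsSetPartition (fibres r)
  fibres-partition = All.tabulate nonempty
    , AllPairs-mapWith disjoint (Unique.filter⁺ (isFibre? r) (subsets-unique n))
    , λ x → lose (fibre∈fibres x) (∈-fibre⁺ r refl)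
    where
    nonempty : ∀ {A} → A ∈ fibres r → Nonempty A
    nonempty A∈ with ∈-fibres⁻ A∈
    ... | c , rc≡c , refl = c , ∈-fibre⁺ r rc≡c
    disjoint : ∀ {A B} → A ∈ fibres r → B ∈ fibres r → A ≢ B → Empty (A ∩ B)
    disjoint A∈ B∈ A≢B (x , x∈) with ∈-fibres⁻ A∈ | ∈-fibres⁻ B∈ | Subset.x∈p∩q⁻ _ _ x∈
    ... | c , _ , refl | d , _ , refl | x∈A , x∈B =
      A≢B (cong (fibre r) (trans (sym (∈-fibre⁻ r x∈A)) (∈-fibre⁻ r x∈B)))

  -- In an overlap `a < b < c < d` the maxima are `c = r a` and `d = r b`, so the discipline
  -- produces an element of the block of `b` below its minimum `b`.
  fibres-nonOverlapping : NonOverlapping (fibres r)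
  fibres-nonOverlapping = All.tabulate λ A∈ → All.tabulate λ B∈ → no-overlap A∈ B∈
    where
    no-overlap : ∀ {A B} → A ∈ fibres r → B ∈ fibres r → ¬ Overlap A B
    no-overlap A∈ B∈ (a , b , c , d , ((a∈ , _) , (b∈ , b-min) , A-max , B-max) , a<b , b<c , c<d)
      with IsMax-unique (fibres-labelling A∈ a∈) A-max
         | IsMax-unique (fibres-labelling B∈ b∈) B-max
    ... | refl | refl with disciplined a<b b<c (ℕ.<-trans b<c c<d) c<d
    ... | z , z<b , e = ℕ.<⇒≱ z<b
      (b-min z (same-label⇒same-block fibres-partition fibres-labelling B∈ b∈ e))

B*-labellings : ∀ n → B* n ≡ length (Labellings.labellings (stack n) n ℕ.≤-refl [])
B*-labellings n = Labellings.length-by-labels (stack n) MaxLabelling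
  (Unique.filter⁺ good? (sublists-unique (subsets-unique n)))
  (λ P∈ → let _ , p , q = ∈⁻ P∈ ; r , R = maxLabelling p in r , maxLabelling-valid p q R , R)
  (λ {r} v → fibres r , ∈-filter⁺ good? (filter-∈-sublists (isFibre? r) (subsets n))
    (fibres-partition v , fibres-nonOverlapping v) , fibres-labelling v)
  (λ P∈ → maxLabelling-functional (proj₁ (proj₂ (∈⁻ P∈))))
  (λ P∈ P′∈ R R′ e → let s , p , _ = ∈⁻ P∈ ; s′ , p′ , _ = ∈⁻ P′∈ in
    sublists-ext (subsets-unique n) s s′
      (maxLabelling-⊆ p p′ R R′ e) (maxLabelling-⊆ p′ p R′ R (sym ∘ e)))
  where
  good? : Decidable (λ P → IsSetPartition P × NonOverlapping P)
  good? P = isSetPartition? P ×-dec nonOverlapping? P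
  ∈⁻ : ∀ {P} → P ∈ nonOverlappingPartitions n →
    P ∈ families n × IsSetPartition P × NonOverlapping P
  ∈⁻ = ∈-filter⁻ good? {xs = families n}

-- Avoiders

-- The letters `c`, `b`, `x` play 3, 2, 1 in the pattern. Avoidance is this relation between each
-- letter `c` and each letter `x` to its right.
NoArrowBefore : (Fin n → Fin n) → Fin n → Fin n → Set
NoArrowBefore h c x = ∀ {b} → h b ≡ c → x < b → b < c → ⊥

avoids⇒ : ∀ (π : Vec (Fin n) n) → Avoids ⟨31⨾2→3⟩ π → AllPairs (NoArrowBefore (hat π)) (toList π)
avoids⇒ π avoids = AllPairs-from-lookup π λ {i} {j} i<j {b} e x<b b<c → avoids
  (lookup π j ∷ b ∷ lookup π i ∷ [] , i ∷ j ∷ [] ,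
   increasing₃ x<b b<c , increasing₂ i<j , refl , e ∷ [])
  where
  increasing₂ : ∀ {m} {a b : Fin m} → a < b → Increasing (a ∷ b ∷ [])
  increasing₂ a<b zero       (suc zero) _ = a<b
  increasing₂ a<b (suc zero) (suc zero) (s≤s ())
  increasing₃ : ∀ {m} {a b c : Fin m} → a < b → b < c → Increasing (a ∷ b ∷ c ∷ [])
  increasing₃ a<b b<c zero (suc zero)       _ = a<b
  increasing₃ a<b b<c zero (suc (suc zero)) _ = ℕ.<-trans a<b b<c
  increasing₃ a<b b<c (suc i) (suc j) i<j = increasing₂ b<c i j (ℕ.s<s⁻¹ i<j)

avoids⇐ : ∀ (π : Vec (Fin n) n) → AllPairs (NoArrowBefore (hat π)) (toList π) → Avoids ⟨31⨾2→3⟩ π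
avoids⇐ π Q (a ∷ b ∷ c ∷ [] , i ∷ j ∷ [] , incx , inct , eq , e ∷ []) with ∷-≡ eq
... | πi≡c , eq′ with ∷-≡ eq′
... | πj≡a , _ = lookup-AllPairs π Q (inct zero (suc zero) (s≤s z≤n)) {b} (trans e (sym πi≡c))
  (subst (_< b) (sym πj≡a) (incx zero (suc zero) (s≤s z≤n)))
  (subst (b <_) (sym πi≡c) (incx (suc zero) (suc (suc zero)) (s≤s (s≤s z≤n))))

-- Images under products of disjoint cycles

successor-range : ∀ (c x : Fin n) xs y → successor c x xs y ≡ y ⊎ successor c x xs y ∈ c ∷ xs
successor-range c x []        y with does (y Fin.≟ x)
... | true  = inj₂ (here refl)
... | false = inj₁ refl
successor-range c x (x′ ∷ xs) y with does (y Fin.≟ x)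
... | true  = inj₂ (there (here refl))
... | false with successor-range c x′ xs y
... | inj₁ e           = inj₁ e
... | inj₂ (here e)    = inj₂ (here e)
... | inj₂ (there q)   = inj₂ (there (there q))

successor-fixes : ∀ (c x : Fin n) xs {y} → y ∉ x ∷ xs → successor c x xs y ≡ y
successor-fixes c x []        {y} y∉ with does (y Fin.≟ x) in eq
... | true  = contradiction (here (does-true (y Fin.≟ x) eq)) y∉
... | false = refl
successor-fixes c x (x′ ∷ xs) {y} y∉ with does (y Fin.≟ x) in eq
... | true  = contradiction (here (does-true (y Fin.≟ x) eq)) y∉
... | false = successor-fixes c x′ xs (y∉ ∘ there)

successor-last : ∀ (c x : Fin n) → successor c x [] x ≡ c
successor-last c x with does (x Fin.≟ x) in eq
... | true  = refl
... | false = contradiction refl (does-false (x Fin.≟ x) eq)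

successor-next : ∀ (c x x′ : Fin n) xs → successor c x (x′ ∷ xs) x ≡ x′
successor-next c x x′ xs with does (x Fin.≟ x) in eq
... | true  = refl
... | false = contradiction refl (does-false (x Fin.≟ x) eq)

successor-skip : ∀ (c x x′ : Fin n) xs {y} → y ≢ x →
  successor c x (x′ ∷ xs) y ≡ successor c x′ xs y
successor-skip c x x′ xs {y} y≢x with does (y Fin.≟ x) in eq
... | true  = contradiction (does-true (y Fin.≟ x) eq) y≢x
... | false = refl

compose : List (List⁺ (Fin n)) → Fin n → Fin n
compose = foldr (λ c f → cycle c ∘ f) id

letters : List (List⁺ (Fin n)) → List (Fin n)
letters = concat ∘ List.map List⁺.toList

cycle-range : ∀ (C : List⁺ (Fin n)) y → cycle C y ≡ y ⊎ cycle C y ∈ List⁺.toList C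
cycle-range (c ∷ ys) = successor-range c c ys

compose-range : ∀ (Cs : List (List⁺ (Fin n))) y → compose Cs y ≡ y ⊎ compose Cs y ∈ letters Cs
compose-range []       y = inj₁ refl
compose-range (C ∷ Cs) y with cycle-range C (compose Cs y)
... | inj₂ q = inj₂ (∈-++⁺ˡ q)
... | inj₁ e with compose-range Cs y
... | inj₁ e′ = inj₁ (trans e e′)
... | inj₂ q  = inj₂ (∈-++⁺ʳ (List⁺.toList C) (subst (_∈ letters Cs) (sym e) q))

compose-fixes : ∀ (Cs : List (List⁺ (Fin n))) {y} → y ∉ letters Cs → compose Cs y ≡ y
compose-fixes []             y∉ = refl
compose-fixes ((c ∷ ys) ∷ Cs) {y} y∉ =
  trans (cong (successor c c ys) (compose-fixes Cs (y∉ ∘ ∈-++⁺ʳ (c ∷ ys))))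
        (successor-fixes c c ys (y∉ ∘ ∈-++⁺ˡ))

unique-++-disjoint : ∀ (xs : List A) {ys a} → Unique (xs ++ ys) → a ∈ xs → a ∉ ys
unique-++-disjoint (x ∷ xs) u (here refl) a∈ys = Unique-head u (∈-++⁺ʳ xs a∈ys)
unique-++-disjoint (x ∷ xs) u (there a∈)  a∈ys = unique-++-disjoint xs (AllPairs.tail u) a∈ a∈ys

compose-on-head : ∀ {c : Fin n} {ys Cs y} → Unique (c ∷ ys ++ letters Cs) → y ∈ c ∷ ys →
  compose ((c ∷ ys) ∷ Cs) y ≡ successor c c ys y
compose-on-head {c = c} {ys} {Cs} u y∈ =
  cong (successor c c ys) (compose-fixes Cs (unique-++-disjoint (c ∷ ys) u y∈))

-- The later cycles keep `y` among their own letters, and the first cycle fixes those.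
compose-on-tail : ∀ {c : Fin n} {ys Cs y} → Unique (c ∷ ys ++ letters Cs) → y ∈ letters Cs →
  compose ((c ∷ ys) ∷ Cs) y ≡ compose Cs y
compose-on-tail {c = c} {ys} {Cs} {y} u y∈ =
  successor-fixes c c ys (λ q → unique-++-disjoint (c ∷ ys) u q image∈)
  where
  image∈ : compose Cs y ∈ letters Cs
  image∈ with compose-range Cs y
  ... | inj₁ e = subst (_∈ letters Cs) (sym e) y∈
  ... | inj₂ q = q

-- Left-to-right maxima and the scan of a word

cutAfter-letters : ∀ (c : Fin n) xs →
  proj₁ (cutAfter c xs) ++ letters (proj₂ (cutAfter c xs)) ≡ xs
cutAfter-letters c []       = refl
cutAfter-letters c (x ∷ xs) with does (c Fin.<? x)
... | true  = cong (x ∷_) (cutAfter-letters x xs)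
... | false = cong (x ∷_) (cutAfter-letters c xs)

-- Here `c` is the maximum of what has been read, and `r` sends each remaining letter to the
-- left-to-right maximum that starts its cycle in π̂.
data RunningMax (r : Fin n → Fin n) : Fin n → List (Fin n) → Set where
  []  : ∀ {c} → RunningMax r c []
  cut : ∀ {c x xs} → c < x → r x ≡ x → RunningMax r x xs → RunningMax r c (x ∷ xs)
  add : ∀ {c x xs} → ¬ c < x → r x ≡ c → RunningMax r c xs → RunningMax r c (x ∷ xs)

-- x ∷ xs is a final segment of a word with running maximum c; h sends each letter to
-- its image under π̂ as the segment determines it.
data Scan (h r : Fin n → Fin n) : Fin n → Fin n → List (Fin n) → Set where
  end : ∀ {c x} → h x ≡ c → Scan h r c x []
  cut : ∀ {c x y ys} → c < y → h x ≡ c → r y ≡ y → Scan h r y y ys → Scan h r c x (y ∷ ys)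
  add : ∀ {c x y ys} → h x ≡ y → r y ≡ c → Scan h r c y ys → Scan h r c x (y ∷ ys)

-- The hypotheses describe `h` on the rest of the current cycle and on the later cycles. At a cut
-- the second one splits into the next cycle and those after it; inside a cycle, `x` is skipped
-- because letters do not repeat.
scan : ∀ {h r : Fin n → Fin n} c x xs → Unique (x ∷ xs) → RunningMax r c xs →
  (∀ {y} → y ∈ x ∷ proj₁ (cutAfter c xs) → h y ≡ successor c x (proj₁ (cutAfter c xs)) y) →
  (∀ {y} → y ∈ letters (proj₂ (cutAfter c xs)) → h y ≡ compose (proj₂ (cutAfter c xs)) y) →
  Scan h r c x xs
scan c x []       u _ h₁ h₂ = end (trans (h₁ (here refl)) (successor-last c x))
scan c x (y ∷ ys) u R h₁ h₂ with does (c Fin.<? y) in eq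
scan c x (y ∷ ys) u (add ¬c<y _ _) h₁ h₂ | true = contradiction (does-true (c Fin.<? y) eq) ¬c<y
scan c x (y ∷ ys) u (cut c<y ry≡y R) h₁ h₂ | true =
  cut c<y (trans (h₁ (here refl)) (successor-last c x)) ry≡y
    (scan y y ys (AllPairs.tail u) R
      (λ q → trans (h₂ (∈-++⁺ˡ q)) (compose-on-head {Cs = Cs} u′ q))
      (λ q → trans (h₂ (∈-++⁺ʳ (y ∷ zs) q)) (compose-on-tail {Cs = Cs} u′ q)))
  where
  zs = proj₁ (cutAfter y ys)
  Cs = proj₂ (cutAfter y ys)
  u′ : Unique (y ∷ zs ++ letters Cs)
  u′ = subst (λ xs → Unique (y ∷ xs)) (sym (cutAfter-letters y ys)) (AllPairs.tail u)
scan c x (y ∷ ys) u (cut c<y _ _) h₁ h₂ | false = contradiction c<y (does-false (c Fin.<? y) eq)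
scan c x (y ∷ ys) u (add _ ry≡c R) h₁ h₂ | false =
  add (trans (h₁ (here refl)) (successor-next c x y zs)) ry≡c
    (scan c y ys (AllPairs.tail u) R
      (λ q → trans (h₁ (there q))
        (successor-skip c x y zs (λ { refl → Unique-head u (block⊆ q) })))
      h₂)
  where
  zs = proj₁ (cutAfter c ys)
  block⊆ : ∀ {z} → z ∈ y ∷ zs → z ∈ y ∷ ys
  block⊆ {z} q = subst (λ xs → z ∈ y ∷ xs) (cutAfter-letters c ys) (∈-++⁺ˡ q)

hat-scan : ∀ {r : Fin (suc n) → Fin (suc n)} x (π : Vec (Fin (suc n)) n) → Unique (x ∷ toList π) →
  RunningMax r x (toList π) → Scan (hat (x ∷ π)) r x x (toList π)
hat-scan x π u R =
  scan x x (toList π) u R (compose-on-head {Cs = Cs} u′) (compose-on-tail {Cs = Cs} u′)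
  where
  Cs = proj₂ (cutAfter x (toList π))
  u′ : Unique (x ∷ proj₁ (cutAfter x (toList π)) ++ letters Cs)
  u′ = subst (λ xs → Unique (x ∷ xs)) (sym (cutAfter-letters x (toList π))) u

-- The labelling of a word

Labelled : (Fin n → Fin n) → List (Fin n) → Set
Labelled r []       = ⊤
Labelled r (x ∷ xs) = r x ≡ x × RunningMax r x xs

override : Fin n → Fin n → (Fin n → Fin n) → Fin n → Fin n
override x v r z with z Fin.≟ x
... | yes _ = v
... | no  _ = r z

override-at : ∀ (x v : Fin n) r → override x v r x ≡ v
override-at x v r with x Fin.≟ x
... | yes _ = refl
... | no x≢x = contradiction refl x≢x

override-off : ∀ (x v : Fin n) r {z} → z ≢ x → override x v r z ≡ r z
override-off x v r {z} z≢x with z Fin.≟ x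
... | yes z≡x = contradiction z≡x z≢x
... | no  _   = refl

RunningMax-cong : ∀ {r r′ : Fin n → Fin n} {c xs} → (∀ {z} → z ∈ xs → r z ≡ r′ z) →
  RunningMax r c xs → RunningMax r′ c xs
RunningMax-cong e []            = []
RunningMax-cong e (cut c<x q R) =
  cut c<x (trans (sym (e (here refl))) q) (RunningMax-cong (e ∘ there) R)
RunningMax-cong e (add c≮x q R) =
  add c≮x (trans (sym (e (here refl))) q) (RunningMax-cong (e ∘ there) R)

RunningMax-override : ∀ {r : Fin n → Fin n} {x v c xs} → x ∉ xs → RunningMax r c xs →
  RunningMax (override x v r) c xs
RunningMax-override {r = r} x∉ =
  RunningMax-cong λ z∈ → sym (override-off _ _ r (λ { refl → x∉ z∈ }))

-- Built from the right; overriding the value at `x` is harmless, since `x` does not recur in `xs`.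
runningMax : ∀ (c : Fin n) {xs} → Unique xs → ∃[ r ] RunningMax r c xs
runningMax c {[]}     u = id , []
runningMax c {x ∷ xs} u with c Fin.<? x
... | yes c<x = let r , R = runningMax x (AllPairs.tail u) in
  override x x r , cut c<x (override-at x x r) (RunningMax-override (Unique-head u) R)
... | no c≮x  = let r , R = runningMax c (AllPairs.tail u) in
  override x c r , add c≮x (override-at x c r) (RunningMax-override (Unique-head u) R)

labelled : ∀ {xs : List (Fin n)} → Unique xs → ∃[ r ] Labelled r xs
labelled {xs = []}     u = id , _
labelled {xs = x ∷ xs} u = let r , R = runningMax x (AllPairs.tail u) in
  override x x r , override-at x x r , RunningMax-override (Unique-head u) R

RunningMax-functional : ∀ {r r′ : Fin n → Fin n} {c xs} → RunningMax r c xs →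
  RunningMax r′ c xs → ∀ {z} → z ∈ xs → r z ≡ r′ z
RunningMax-functional (cut _ e _)   (cut _ e′ _)   (here refl) = trans e (sym e′)
RunningMax-functional (add _ e _)   (add _ e′ _)   (here refl) = trans e (sym e′)
RunningMax-functional (cut _ _ R)   (cut _ _ R′)   (there z∈)  = RunningMax-functional R R′ z∈
RunningMax-functional (add _ _ R)   (add _ _ R′)   (there z∈)  = RunningMax-functional R R′ z∈
RunningMax-functional (cut c<x _ _) (add c≮x _ _)  _           = contradiction c<x c≮x
RunningMax-functional (add c≮x _ _) (cut c<x _ _)  _           = contradiction c<x c≮x

Labelled-functional : ∀ {r r′ : Fin n → Fin n} {xs} → Labelled r xs → Labelled r′ xs →
  ∀ {z} → z ∈ xs → r z ≡ r′ z
Labelled-functional {xs = x ∷ xs} (e , R) (e′ , R′) (here refl) = trans e (sym e′)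
Labelled-functional {xs = x ∷ xs} (e , R) (e′ , R′) (there z∈)  = RunningMax-functional R R′ z∈

RunningMax-closed : ∀ {r : Fin n → Fin n} {c xs} → r c ≡ c → RunningMax r c xs → ∀ {z} →
  z ∈ xs → z ≤ r z × r (r z) ≡ r z
RunningMax-closed {r = r} rc (cut _ e R)   (here refl) = Fin.≤-reflexive (sym e) , cong r e
RunningMax-closed {r = r} rc (add c≮x e R) (here refl) =
  subst (_ ≤_) (sym e) (ℕ.≮⇒≥ c≮x) , trans (cong r e) (trans rc (sym e))
RunningMax-closed rc (cut _ e R)   (there z∈)  = RunningMax-closed e R z∈
RunningMax-closed rc (add _ e R)   (there z∈)  = RunningMax-closed rc R z∈

Labelled-closed : ∀ {r : Fin n → Fin n} {xs} → Labelled r xs → ∀ {z} → z ∈ xs →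
  z ≤ r z × r (r z) ≡ r z
Labelled-closed {r = r} {x ∷ xs} (e , R) (here refl) = Fin.≤-reflexive (sym e) , cong r e
Labelled-closed {xs = x ∷ xs} (e , R) (there z∈)  = RunningMax-closed e R z∈

-- The order of the letters in an avoider: blocks by increasing maximum, each decreasing.
infix 4 _≺[_]_
_≺[_]_ : Fin n → (Fin n → Fin n) → Fin n → Set
x ≺[ r ] y = r x < r y ⊎ (r x ≡ r y × y < x)

≺-trans : ∀ {r : Fin n → Fin n} {x y z} → x ≺[ r ] y → y ≺[ r ] z → x ≺[ r ] z
≺-trans (inj₁ p)       (inj₁ q)        = inj₁ (ℕ.<-trans p q)
≺-trans (inj₁ p)       (inj₂ (e , _))  = inj₁ (subst (toℕ _ ℕ.<_) (cong toℕ e) p)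
≺-trans (inj₂ (e , _)) (inj₁ q)        = inj₁ (subst (ℕ._< toℕ _) (cong toℕ (sym e)) q)
≺-trans (inj₂ (e , p)) (inj₂ (e′ , q)) = inj₂ (trans e e′ , ℕ.<-trans q p)

≺-asym : ∀ {r : Fin n → Fin n} {x y} → x ≺[ r ] y → ¬ y ≺[ r ] x
≺-asym (inj₁ p)       (inj₁ q)       = ℕ.<-asym p q
≺-asym (inj₁ p)       (inj₂ (e , _)) = ℕ.<⇒≢ p (cong toℕ (sym e))
≺-asym (inj₂ (e , _)) (inj₁ q)       = ℕ.<⇒≢ q (cong toℕ (sym e))
≺-asym (inj₂ (_ , p)) (inj₂ (_ , q)) = ℕ.<-asym p q

≺-irrefl : ∀ {r : Fin n → Fin n} {x} → ¬ x ≺[ r ] x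
≺-irrefl {r = r} p = ≺-asym {r = r} p p

≺-≤ : ∀ {r : Fin n → Fin n} {x y} → x ≺[ r ] y → r x ≤ r y
≺-≤ (inj₁ p)       = ℕ.<⇒≤ p
≺-≤ (inj₂ (e , _)) = Fin.≤-reflexive e

≺-same : ∀ {r : Fin n → Fin n} {x y} → r x ≡ r y → x ≺[ r ] y → y < x
≺-same e (inj₁ p)       = contradiction (cong toℕ e) (ℕ.<⇒≢ p)
≺-same e (inj₂ (_ , q)) = q

≺-after : ∀ {r : Fin n → Fin n} {x y ys} → x ≺[ r ] y → (∀ {z} → x ≺[ r ] z → z ∈ y ∷ ys) →
  ∀ {z} → y ≺[ r ] z → z ∈ ys
≺-after {r = r} x≺y after y≺z with after (≺-trans {r = r} x≺y y≺z)
... | here refl = ⊥-elim (≺-irrefl {r = r} y≺z)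
... | there q   = q

-- Decreasing blocks and the action of π̂ on them

module _ {h r : Fin n → Fin n} (inflationary : ∀ z → z ≤ r z) where

  -- The witness is the last letter of the current block, which `h` sends back to the first letter
  -- `c`.
  scan-closer : ∀ {c x xs} → Scan h r c x xs → r x ≡ c → ∃[ e ] e ∈ x ∷ xs × h e ≡ c × r e ≡ c
  scan-closer (end hx≡c)         rx≡c = _ , here refl , hx≡c , rx≡c
  scan-closer (cut _ hx≡c _ _)   rx≡c = _ , here refl , hx≡c , rx≡c
  scan-closer (add _ ry≡c S)     rx≡c = let e , e∈ , q = scan-closer S ry≡c in e , there e∈ , q

  -- Labels grow at a cut. Inside a block, the letter `y` after `x` is smaller at once if `x ≡ c`.
  -- Otherwise let `e` be the last letter of the block: the arrow from `e` to `c`, with `c` left of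
  -- `x`, forces `e < x`. If `x < y`, then `e` comes after `y`, and the arrow from `x` to `y` with
  -- `e < x < y` is the pattern. The last hypothesis records whether the block has just begun.
  scan-sorted : ∀ {c x xs} → Scan h r c x xs → r x ≡ c → Unique (x ∷ xs) →
    AllPairs (NoArrowBefore h) (x ∷ xs) →
    x ≡ c ⊎ All (λ z → NoArrowBefore h c z × z ≢ c) (x ∷ xs) → Linked _≺[ r ]_ (x ∷ xs)
  scan-sorted (end _) rx≡c u Q _ = [-]
  scan-sorted (cut c<y hx≡c ry≡y S) rx≡c (_ ∷ u) (_ ∷ Q) _ =
    inj₁ (subst (ℕ._< _) (cong toℕ (sym rx≡c)) (subst (toℕ _ ℕ.<_) (cong toℕ (sym ry≡y)) c<y))
    ∷ scan-sorted S ry≡y u Q (inj₁ refl)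
  scan-sorted {c} {x} {y ∷ ys} (add hx≡y ry≡c S) rx≡c u@(x∉ ∷ u′) (Qx ∷ Q) start =
    inj₂ (trans rx≡c (sym ry≡c) , y<x start) ∷ scan-sorted S ry≡c u′ Q (inj₂ (rest start))
    where
    rest : x ≡ c ⊎ All (λ z → NoArrowBefore h c z × z ≢ c) (x ∷ y ∷ ys) →
      All (λ z → NoArrowBefore h c z × z ≢ c) (y ∷ ys)
    rest (inj₁ refl)    = All.zip (Qx , All.map (λ x≢z z≡x → x≢z (sym z≡x)) x∉)
    rest (inj₂ (_ ∷ q)) = q
    y≢x : y ≢ x
    y≢x refl = Unique-head u (here refl)
    y<x : x ≡ c ⊎ All (λ z → NoArrowBefore h c z × z ≢ c) (x ∷ y ∷ ys) → y < x
    y<x (inj₁ refl) = Fin.≤∧≢⇒< (subst (y ≤_) ry≡c (inflationary y)) y≢x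
    y<x (inj₂ ((Qc , _) ∷ q)) with scan-closer S ry≡c
    ... | e , e∈ , he≡c , re≡c with Fin.<-cmp y x
    ... | tri< y<x _ _ = y<x
    ... | tri≈ _ e _ = contradiction e y≢x
    ... | tri> _ _ x<y = ⊥-elim (last e∈)
      where
      e<x : e < x
      e<x = Fin.≤∧≢⇒< (ℕ.≮⇒≥ λ x<e → Qc he≡c x<e
        (Fin.≤∧≢⇒< (subst (e ≤_) re≡c (inflationary e)) (proj₂ (All.lookup q e∈))))
        (λ { refl → Unique-head u e∈ })
      last : e ∈ y ∷ ys → ⊥
      last (here refl) = ℕ.<-asym e<x x<y
      last (there e∈′) = All.lookup (AllPairs.head Q) e∈′ hx≡y e<x x<y

  -- The witness is the last letter of the block of `y`; blocks decrease, so it is at most `y`.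
  scan-block-min : ∀ {c x xs} → Scan h r c x xs → r x ≡ c → AllPairs _≺[ r ]_ (x ∷ xs) →
    ∀ {y} → y ∈ x ∷ xs → ∃[ e ] h e ≡ r y × r e ≡ r y × e ≤ y
  scan-block-min (end hx≡c) rx≡c so (here refl) = _ , trans hx≡c (sym rx≡c) , refl , ℕ.≤-refl
  scan-block-min (cut _ hx≡c _ _) rx≡c so (here refl) =
    _ , trans hx≡c (sym rx≡c) , refl , ℕ.≤-refl
  scan-block-min (add _ ry≡c S) rx≡c ((x≺y ∷ _) ∷ so) (here refl) =
    let e , he , re , e≤y = scan-block-min S ry≡c so (here refl)
        ry≡rx = trans ry≡c (sym rx≡c)
    in e , trans he ry≡rx , trans re ry≡rx ,
       ℕ.≤-trans e≤y (ℕ.<⇒≤ (≺-same {r = r} (sym ry≡rx) x≺y))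
  scan-block-min (cut _ _ ry≡y S) rx≡c (_ ∷ so) (there y∈) = scan-block-min S ry≡y so y∈
  scan-block-min (add _ ry≡c S) rx≡c (_ ∷ so) (there y∈) = scan-block-min S ry≡c so y∈

  -- Inside a block the image is the next, smaller letter. The last letter goes to its label and is
  -- the minimum: by `after`, a smaller element of its block would still have to come, but all later
  -- labels are larger.
  scan-hat : ∀ {c x xs} → Scan h r c x xs → r x ≡ c → AllPairs _≺[ r ]_ (x ∷ xs) →
    (∀ {z} → x ≺[ r ] z → z ∈ xs) →
    ∀ {b} → b ∈ x ∷ xs → h b < b ⊎ (h b ≡ r b × ∀ {z} → z < b → r z ≢ r b)
  scan-hat (end hx≡c) rx≡c so after (here refl) =
    inj₂ (trans hx≡c (sym rx≡c) ,
      λ z<x rz≡rx → contradiction (after (inj₂ (sym rz≡rx , z<x))) λ ())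
  scan-hat {c} {x} {y ∷ ys} (cut c<y hx≡c ry≡y S) rx≡c (_ ∷ (y≺ ∷ so)) after (here refl) =
    inj₂ (trans hx≡c (sym rx≡c) , λ z<x rz≡rx → later (after (inj₂ (sym rz≡rx , z<x))) rz≡rx)
    where
    c<ry : c < r y
    c<ry = subst (c <_) (sym ry≡y) c<y
    later : ∀ {z} → z ∈ y ∷ ys → r z ≢ r x
    later (here refl) e = ℕ.<⇒≢ c<ry (cong toℕ (sym (trans e rx≡c)))
    later (there z∈) e =
      ℕ.<⇒≢ (ℕ.<-≤-trans c<ry (≺-≤ {r = r} (All.lookup y≺ z∈))) (cong toℕ (sym (trans e rx≡c)))
  scan-hat (add hx≡y ry≡c S) rx≡c ((x≺y ∷ _) ∷ so) after (here refl) =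
    inj₁ (subst (_< _) (sym hx≡y) (≺-same {r = r} (trans rx≡c (sym ry≡c)) x≺y))
  scan-hat (cut _ _ ry≡y S) rx≡c ((x≺y ∷ _) ∷ so) after (there b∈) =
    scan-hat S ry≡y so (≺-after x≺y after) b∈
  scan-hat (add _ ry≡c S) rx≡c ((x≺y ∷ _) ∷ so) after (there b∈) =
    scan-hat S ry≡c so (≺-after x≺y after) b∈

-- From valid labellings to avoiders

module _ {r : Fin n → Fin n} (v : Valid (queue n) r) where
  open Valid v

  ¬≺-label : ∀ {x} → ¬ x ≺[ r ] r x
  ¬≺-label {x} (inj₁ p)       = ℕ.<⇒≢ p (cong toℕ (sym (idempotent x)))
  ¬≺-label {x} (inj₂ (_ , p)) = ℕ.<⇒≱ p (inflationary x)

  -- When the label changes at `y`, the label `r y` is still in the list, and by `¬≺-label` it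
  -- cannot come after `y`. So `y` is its own label and a new left-to-right maximum.
  sorted⇒runningMax : ∀ {c xs} → r c ≡ c → AllPairs _≺[ r ]_ (c ∷ xs) →
    (∀ {z} → z ∈ xs → r z ≡ c ⊎ r z ∈ xs) → RunningMax r c xs
  sorted⇒runningMax {xs = []}     rc _ _ = []
  sorted⇒runningMax {c} {y ∷ ys} rc ((inj₁ rc<ry ∷ _) ∷ so@(y≺ ∷ _)) closed =
    cut c<y ry≡y (sorted⇒runningMax ry≡y so closed′)
    where
    c<ry : c < r y
    c<ry = subst (_< r y) rc rc<ry
    ry≡y : r y ≡ y
    ry≡y with closed (here refl)
    ... | inj₁ e         = contradiction (cong toℕ (sym e)) (ℕ.<⇒≢ c<ry)
    ... | inj₂ (here e)  = e
    ... | inj₂ (there q) = ⊥-elim (¬≺-label (All.lookup y≺ q))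
    c<y : c < y
    c<y = subst (c <_) ry≡y c<ry
    closed′ : ∀ {z} → z ∈ ys → r z ≡ y ⊎ r z ∈ ys
    closed′ z∈ with closed (there z∈)
    ... | inj₁ e         =
      contradiction (cong toℕ (sym e)) (ℕ.<⇒≢ (ℕ.<-≤-trans c<ry (≺-≤ {r = r} (All.lookup y≺ z∈))))
    ... | inj₂ (here e)  = inj₁ e
    ... | inj₂ (there q) = inj₂ q
  sorted⇒runningMax {c} {y ∷ ys} rc ((inj₂ (rc≡ry , y<c) ∷ c≺) ∷ (_ ∷ so)) closed =
    add (ℕ.<-asym y<c) ry≡c (sorted⇒runningMax rc (c≺ ∷ so) closed′)
    where
    ry≡c : r y ≡ c
    ry≡c = trans (sym rc≡ry) rc
    closed′ : ∀ {z} → z ∈ ys → r z ≡ c ⊎ r z ∈ ys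
    closed′ {z} z∈ with closed (there z∈)
    ... | inj₁ e         = inj₁ e
    ... | inj₂ (here e)  = inj₁ (trans (sym (idempotent z)) (trans (cong r e) ry≡c))
    ... | inj₂ (there q) = inj₂ q

  sorted⇒labelled : ∀ {xs} → AllPairs _≺[ r ]_ xs → (∀ z → z ∈ xs) → Labelled r xs
  sorted⇒labelled {[]}     _         _        = _
  sorted⇒labelled {x ∷ xs} so@(x≺ ∷ _) complete =
    rx≡x (complete (r x)) , sorted⇒runningMax (rx≡x (complete (r x))) so closed
    where
    rx≡x : r x ∈ x ∷ xs → r x ≡ x
    rx≡x (here e)  = e
    rx≡x (there q) = ⊥-elim (¬≺-label (All.lookup x≺ q))
    closed : ∀ {z} → z ∈ xs → r z ≡ x ⊎ r z ∈ xs
    closed {z} _ with complete (r z)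
    ... | here e  = inj₁ e
    ... | there q = inj₂ q

  -- An arrow from `b` up to `c` leaves the minimum `b` of a block with maximum `c`. A letter
  -- `y < b` after `c` is not in that block, so its label is larger; then `y < b < r b < r y`, and
  -- the discipline gives an element of the block below `b`.
  sorted⇒noArrowBefore : ∀ {h x xs} → Scan h r x x xs → r x ≡ x → AllPairs _≺[ r ]_ (x ∷ xs) →
    (∀ z → z ∈ x ∷ xs) → AllPairs (NoArrowBefore h) (x ∷ xs)
  sorted⇒noArrowBefore {h} {x} {xs} S rx≡x so complete = AllPairs.map noArrow so
    where
    after : ∀ {z} → x ≺[ r ] z → z ∈ xs
    after {z} x≺z with complete z
    ... | here refl = ⊥-elim (≺-irrefl {r = r} x≺z)
    ... | there q   = q
    noArrow : ∀ {c y} → c ≺[ r ] y → NoArrowBefore h c y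
    noArrow {c} {y} c≺y {b} hb≡c y<b b<c with scan-hat inflationary S rx≡x so after (complete b)
    ... | inj₁ hb<b = ℕ.<-asym b<c (subst (_< b) hb≡c hb<b)
    ... | inj₂ (hb≡rb , last) = above c≺y
      where
      c≡rb : c ≡ r b
      c≡rb = trans (sym hb≡c) hb≡rb
      rc≡rb : r c ≡ r b
      rc≡rb = trans (cong r c≡rb) (idempotent b)
      above : c ≺[ r ] y → ⊥
      above (inj₂ (rc≡ry , _)) = last y<b (trans (sym rc≡ry) rc≡rb)
      above (inj₁ rc<ry) =
        let z , z<b , e = disciplined y<b (ℕ.<-trans b<rb rb<ry) b<rb rb<ry in last z<b e
        where
        b<rb : b < r b
        b<rb = subst (b <_) c≡rb b<c
        rb<ry : r b < r y
        rb<ry = subst (_< r y) rc≡rb rc<ry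

descending : ∀ n → List (Fin n)
descending n = tabulate opposite

opposite-< : ∀ {i j : Fin n} → i < j → opposite j < opposite i
opposite-< {n} {i} {j} i<j = subst (ℕ._< toℕ (opposite i)) (sym (Fin.opposite-prop j))
  (subst (n ℕ.∸ suc (toℕ j) ℕ.<_) (sym (Fin.opposite-prop i))
    (ℕ.∸-monoʳ-< (s≤s i<j) (Fin.toℕ<n j)))

-- For a valid labelling this is the word of the corresponding avoider.
sortByLabel : (Fin n → Fin n) → List (Fin n)
sortByLabel {n} r = concat (tabulate λ c → filter (λ x → r x Fin.≟ c) (descending n))

sortByLabel-complete : ∀ (r : Fin n → Fin n) z → z ∈ sortByLabel r
sortByLabel-complete {n} r z = ∈-concat⁺′
  (∈-filter⁺ (λ x → r x Fin.≟ r z)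
    (subst (_∈ descending n) (Fin.opposite-involutive z) (∈-tabulate⁺ (opposite z))) refl)
  (∈-tabulate⁺ (r z))

sortByLabel-sorted : ∀ (r : Fin n → Fin n) → AllPairs _≺[ r ]_ (sortByLabel r)
sortByLabel-sorted {n} r = AllPairs.concat⁺
  (All.tabulate⁺ class-sorted)
  (AllPairs.tabulate⁺-< λ c<d → All.tabulate λ x∈ → All.tabulate λ y∈ →
    inj₁ (subst (_< _) (sym (∈⁻ x∈)) (subst (_ <_) (sym (∈⁻ y∈)) c<d)))
  where
  class : Fin n → List (Fin n)
  class c = filter (λ x → r x Fin.≟ c) (descending n)
  ∈⁻ : ∀ {c x} → x ∈ class c → r x ≡ c
  ∈⁻ {c} x∈ = proj₂ (∈-filter⁻ (λ x → r x Fin.≟ c) {xs = descending n} x∈)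
  class-sorted : ∀ c → AllPairs _≺[ r ]_ (class c)
  class-sorted c = AllPairs-mapWith (λ x∈ y∈ y<x → inj₂ (trans (∈⁻ x∈) (sym (∈⁻ y∈)) , y<x))
    (AllPairs.filter⁺ (λ x → r x Fin.≟ c) (AllPairs.tabulate⁺-< {f = opposite} opposite-<))


-- From avoiders to valid labellings

module _ {x : Fin (suc n)} {π : Vec (Fin (suc n)) n} (u : Unique (x ∷ toList π))
         (avoids : Avoids ⟨31⨾2→3⟩ (x ∷ π)) where
  private
    h = hat (x ∷ π)
    xs = toList π
    complete : ∀ z → z ∈ x ∷ xs
    complete = unique-complete u (cong suc (Vec.length-toList π))

    arrows : AllPairs (NoArrowBefore h) (x ∷ xs)
    arrows = avoids⇒ (x ∷ π) avoids

  module _ {r} (L : Labelled r (x ∷ xs)) where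
    private
      inflationary : ∀ z → z ≤ r z
      inflationary z = proj₁ (Labelled-closed L (complete z))
      S : Scan h r x x xs
      S = hat-scan x π u (proj₂ L)

    avoider-sorted : AllPairs _≺[ r ]_ (x ∷ xs)
    avoider-sorted = Linked⇒AllPairs (≺-trans {r = r})
      (scan-sorted inflationary S (proj₁ L) u arrows (inj₁ refl))

    -- For the discipline: let `e` be the last letter of the block of `y`, with image `r y`. As
    -- `r y < r z`, the letter `r y` stands left of `z`, so avoidance forbids `z < e`; hence
    -- `e ≤ z < y`.
    avoider-valid : Valid (queue (suc n)) r
    avoider-valid = record
      { inflationary = inflationary
      ; idempotent   = λ z → proj₂ (Labelled-closed L (complete z))
      ; disciplined  = disciplined
      }
      where
      disciplined : ∀ {z y} → z < y → y < r z → y < r y → r y < r z → ∃[ e ] e < y × r e ≡ r y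
      disciplined {z} {y} z<y y<rz y<ry ry<rz
        with scan-block-min inflationary S (proj₁ L) avoider-sorted (complete y)
      ... | e , he≡ry , re≡ry , e≤y = e , ℕ.≤-<-trans (ℕ.≮⇒≥ z≮e) z<y , re≡ry
        where
        ry≺z : r y ≺[ r ] z
        ry≺z = inj₁ (subst (_< r z) (sym (proj₂ (Labelled-closed L (complete y)))) ry<rz)
        noArrow : NoArrowBefore h (r y) z
        noArrow
          with AllPairs-lookup (AllPairs.zip (arrows , avoider-sorted)) (complete (r y)) (complete z)
        ... | inj₁ e               = ⊥-elim (≺-irrefl {r = r} (subst (r y ≺[ r ]_) (sym e) ry≺z))
        ... | inj₂ (inj₁ (q , _))  = q
        ... | inj₂ (inj₂ (_ , z≺)) = ⊥-elim (≺-asym {r = r} z≺ ry≺z)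
        z≮e : ¬ z < e
        z≮e z<e = noArrow he≡ry z<e (ℕ.≤-<-trans e≤y y<ry)

avoider-of : ∀ {r : Fin (suc n) → Fin (suc n)} → Valid (queue (suc n)) r →
  ∃[ π ] Unique (toList π) × Avoids ⟨31⨾2→3⟩ π × Labelled r (toList π)
avoider-of {n} {r} v
  with fromList-length (sortByLabel r) (complete-length u (sortByLabel-complete r))
  where
  u : Unique (sortByLabel r)
  u = AllPairs.map (λ { p refl → ≺-irrefl {r = r} p }) (sortByLabel-sorted r)
... | x ∷ π , eq = x ∷ π , u , avoids⇐ (x ∷ π)
    (sorted⇒noArrowBefore v (hat-scan x π u (proj₂ L)) (proj₁ L) sorted complete) , L
  where
  sorted : AllPairs _≺[ r ]_ (x ∷ toList π)
  sorted = subst (AllPairs _≺[ r ]_) (sym eq) (sortByLabel-sorted r)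
  complete : ∀ z → z ∈ x ∷ toList π
  complete z = subst (z ∈_) (sym eq) (sortByLabel-complete r z)
  u : Unique (x ∷ toList π)
  u = AllPairs.map (λ { p refl → ≺-irrefl {r = r} p }) sorted
  L : Labelled r (x ∷ toList π)
  L = sorted⇒labelled v sorted complete

-- Counting the avoiders

module _ {k} (σ : ArrowPattern k) where
  private
    avoids? : Decidable (Avoids {n = n} σ)
    avoids? π = ¬? (contains? σ π)

  ∈-𝓢⁻ : ∀ {π} → π ∈ 𝓢 n σ → Unique (toList π) × Avoids σ π
  ∈-𝓢⁻ {n} π∈ = let π∈′ , a = ∈-filter⁻ avoids? {xs = permutations n} π∈ in
    toList-AllPairs⁺ (proj₂ (∈-filter⁻ unique? {xs = words (allFin n) n} π∈′)) , a

  ∈-𝓢⁺ : ∀ (π : Vec (Fin n) n) → Unique (toList π) → Avoids σ π → π ∈ 𝓢 n σ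
  ∈-𝓢⁺ π u a = ∈-filter⁺ avoids? (∈-filter⁺ unique? (∈-words ∈-allFin π) (toList-AllPairs⁻ π u)) a

  𝓢-unique : ∀ n → Unique (𝓢 n σ)
  𝓢-unique n = Unique.filter⁺ avoids? (Unique.filter⁺ unique? (words-unique n (Unique.allFin⁺ n)))

avoiders-labellings : ∀ {πs : List (Vec (Fin (suc n)) (suc n))} → Unique πs →
  (∀ {π} → π ∈ πs → Unique (toList π) × Avoids ⟨31⨾2→3⟩ π) →
  (∀ π → Unique (toList π) → Avoids ⟨31⨾2→3⟩ π → π ∈ πs) →
  length πs ≡ length (Labellings.labellings (queue (suc n)) (suc n) ℕ.≤-refl [])
avoiders-labellings {n} {πs} πs! ∈⁻ ∈⁺ =
  Labellings.length-by-labels (queue (suc n)) (λ π r → Labelled r (toList π))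
  πs!
  (λ { {x ∷ π} π∈ → let u , a = ∈⁻ π∈ ; r , L = labelled u in r , avoider-valid u a L , L })
  (λ v → let π , u , a , L = avoider-of v in
    π , ∈⁺ π u a , L)
  (λ {π} π∈ L L′ i → Labelled-functional L L′ (complete π∈ i))
  (λ { {π} {π′} π∈ π′∈ → injective π π′ π∈ π′∈ })
  where
  complete : ∀ {π} → π ∈ πs → ∀ i → i ∈ toList π
  complete {π} π∈ = unique-complete (proj₁ (∈⁻ π∈)) (Vec.length-toList π)
  injective : ∀ π π′ {r r′} → π ∈ πs → π′ ∈ πs →
    Labelled r (toList π) → Labelled r′ (toList π′) → (∀ i → r i ≡ r′ i) → π ≡ π′
  injective (x ∷ π) (x′ ∷ π′) {r} {r′} π∈ π′∈ L L′ r≗r′ =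
    -- Both words list all letters in the order `≺[ r ]`, so they coincide.
    trans (sym (Vec.cast-is-id refl (x ∷ π))) (Vec.toList-injective refl (x ∷ π) (x′ ∷ π′)
    (sorted-ext (≺-asym {r = r}) (sorted π∈ L) (AllPairs.map transport (sorted π′∈ L′))
      (λ _ → complete π′∈ _) (λ _ → complete π∈ _)))
    where
    sorted : ∀ {y π r} → y ∷ π ∈ πs → Labelled r (y ∷ toList π) → AllPairs _≺[ r ]_ (y ∷ toList π)
    sorted π∈ L = let u , a = ∈⁻ π∈ in avoider-sorted u a L
    transport : ∀ {a b} → a ≺[ r′ ] b → a ≺[ r ] b
    transport {a} {b} p rewrite r≗r′ a | r≗r′ b = p

theorem4p4 : ∀ (n : ℕ) → n ≥ 1 → length (𝓢 n ⟨31⨾2→3⟩) ≡ B* n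
theorem4p4 (suc n) _ =
  trans (avoiders-labellings (𝓢-unique ⟨31⨾2→3⟩ (suc n)) (∈-𝓢⁻ ⟨31⨾2→3⟩) (∈-𝓢⁺ ⟨31⨾2→3⟩))
  (trans (labellings-length (queue (suc n)) (stack (suc n)) (suc n) ℕ.≤-refl [] [] refl)
         (sym (B*-labellings (suc n))))
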